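{- Termination of loops of the form ${\tt P_1}$ over $\mathbb{Z}$ is undecidable: there is no algorithm which, given $N,m\ge1$, a matrix $A\in\mathbb{Q}^{N\times N}$ and polynomials $P_1,\ldots,P_m\in\mathbb{Q}[x_1,\ldots,x_N]$, decides whether the loop \[ {\bf while}\ \big(P_1(X)>0\wedge\cdots\wedge P_m(X)>0\big)\ \{X:=AX\} \] terminates for every input $X\in\mathbb{Z}^N$.
   Context: The loop terminates on input $X$ if there exists $n\ge0$ such that $P_i(A^nX)\le 0$ for some $i$. The loop is called terminating over $\mathbb{Z}$ if it terminates on every input $X\in\mathbb{Z}^N$. -}

module Defs where

open import Data.Nat as ℕ using (ℕ; zero; suc; _<_)
open import Data.Integer as ℤ using (ℤ; +_; -[1+_])
open import Data.Rational as ℚ using (ℚ; 0ℚ; _/_)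
open import Data.Fin using (Fin; toℕ) renaming (zero to fzero; suc to fsuc)
open import Data.Vec using (Vec; []; _∷_)
open import Data.List using (List; []; _∷_)
open import Data.Product using (Σ; ∃; _×_; _,_)
open import Relation.Nullary using (¬_)

-- Polynomials in N variables with rational coefficients (syntax;
-- every element of ℚ[x_1..x_N] is represented).
data Poly (N : ℕ) : Set where
  con : ℚ → Poly N
  var : Fin N → Poly N
  add : Poly N → Poly N → Poly N
  mul : Poly N → Poly N → Poly N

evalPoly : {N : ℕ} → Poly N → (Fin N → ℚ) → ℚ
evalPoly (con q)   X = q
evalPoly (var i)   X = X i
evalPoly (add p q) X = evalPoly p X ℚ.+ evalPoly q X
evalPoly (mul p q) X = evalPoly p X ℚ.* evalPoly q X

Matrix : ℕ → Set
Matrix N = Fin N → Fin N → ℚ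

sumFin : (n : ℕ) → (Fin n → ℚ) → ℚ
sumFin zero    f = 0ℚ
sumFin (suc n) f = f fzero ℚ.+ sumFin n (λ j → f (fsuc j))

_·_ : {N : ℕ} → Matrix N → (Fin N → ℚ) → (Fin N → ℚ)
_·_ {N} A X i = sumFin N (λ j → A i j ℚ.* X j)

pow· : {N : ℕ} → Matrix N → ℕ → (Fin N → ℚ) → (Fin N → ℚ)
pow· A zero    X = X
pow· A (suc n) X = A · pow· A n X

toℚ : ℤ → ℚ
toℚ z = z / 1

-- An instance: N = suc n ≥ 1 variables, m = suc k ≥ 1 guards.
record Instance : Set where
  constructor inst
  field
    n : ℕ
    k : ℕ
    A : Matrix (suc n)
    P : Fin (suc k) → Poly (suc n)

TerminatesOn : (I : Instance) → (Fin (suc (Instance.n I)) → ℤ) → Set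
TerminatesOn (inst n k A P) X =
  Σ ℕ λ t → Σ (Fin (suc k)) λ i →
    evalPoly (P i) (pow· A t (λ j → toℚ (X j))) ℚ.≤ 0ℚ

TerminatingOverℤ : Instance → Set
TerminatingOverℤ I = (X : Fin (suc (Instance.n I)) → ℤ) → TerminatesOn I X

data PR : ℕ → Set where
  Z    : PR 0
  S    : PR 1
  proj : {a : ℕ} → Fin a → PR a
  comp : {a b : ℕ} → PR b → Vec (PR a) b → PR a
  prec : {a : ℕ} → PR a → PR (suc (suc a)) → PR (suc a)
  mu   : {a : ℕ} → PR (suc a) → PR a

lookupV : {A : Set} {a : ℕ} → Vec A a → Fin a → A
lookupV (x ∷ xs) fzero    = x
lookupV (x ∷ xs) (fsuc i) = lookupV xs i

mutual
  data Eval : {a : ℕ} → PR a → Vec ℕ a → ℕ → Set where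
    eZ    : Eval Z [] 0
    eS    : (x : ℕ) → Eval S (x ∷ []) (suc x)
    eproj : {a : ℕ} (i : Fin a) (xs : Vec ℕ a) → Eval (proj i) xs (lookupV xs i)
    ecomp : {a b : ℕ} {f : PR b} {gs : Vec (PR a) b} {xs : Vec ℕ a}
            {ys : Vec ℕ b} {z : ℕ} →
            EvalV gs xs ys → Eval f ys z → Eval (comp f gs) xs z
    eprec0 : {a : ℕ} {f : PR a} {g : PR (suc (suc a))} {xs : Vec ℕ a} {z : ℕ} →
             Eval f xs z → Eval (prec f g) (0 ∷ xs) z
    eprecS : {a : ℕ} {f : PR a} {g : PR (suc (suc a))} {xs : Vec ℕ a}
             {t r z : ℕ} →
             Eval (prec f g) (t ∷ xs) r → Eval g (t ∷ r ∷ xs) z →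
             Eval (prec f g) (suc t ∷ xs) z
    emu   : {a : ℕ} {f : PR (suc a)} {xs : Vec ℕ a} {y : ℕ} →
            Eval f (y ∷ xs) 0 →
            ((z : ℕ) → z < y → Σ ℕ λ w → Eval f (z ∷ xs) (suc w)) →
            Eval (mu f) xs y

  data EvalV : {a b : ℕ} → Vec (PR a) b → Vec ℕ a → Vec ℕ b → Set where
    [] : {a : ℕ} {xs : Vec ℕ a} → EvalV [] xs []
    _∷_ : {a b : ℕ} {g : PR a} {gs : Vec (PR a) b} {xs : Vec ℕ a}
          {y : ℕ} {ys : Vec ℕ b} →
          Eval g xs y → EvalV gs xs ys → EvalV (g ∷ gs) xs (y ∷ ys)

tri : ℕ → ℕ
tri zero    = 0
tri (suc t) = suc t ℕ.+ tri t

-- Cantor pairing (bijection ℕ × ℕ → ℕ)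
pair : ℕ → ℕ → ℕ
pair a b = tri (a ℕ.+ b) ℕ.+ b

encList : List ℕ → ℕ
encList []       = 0
encList (x ∷ xs) = suc (pair x (encList xs))

encFun : (n : ℕ) → (Fin n → ℕ) → ℕ
encFun n f = encList (go n f)
  where
  go : (n : ℕ) → (Fin n → ℕ) → List ℕ
  go zero    f = []
  go (suc n) f = f fzero ∷ go n (λ j → f (fsuc j))

encℤ : ℤ → ℕ
encℤ (+ n)      = n ℕ.* 2
encℤ -[1+ n ]   = suc (n ℕ.* 2)

encℚ : ℚ → ℕ
encℚ q = pair (encℤ (ℚ.numerator q)) (ℚ.denominator-1 q)

encPoly : {N : ℕ} → Poly N → ℕ
encPoly (con q)   = pair 0 (encℚ q)
encPoly (var i)   = pair 1 (toℕ i)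
encPoly (add p q) = pair 2 (pair (encPoly p) (encPoly q))
encPoly (mul p q) = pair 3 (pair (encPoly p) (encPoly q))

encInstance : Instance → ℕ
encInstance (inst n k A P) =
  pair n (pair k (pair (encFun (suc n) (λ i → encFun (suc n) (λ j → encℚ (A i j))))
                       (encFun (suc k) (λ i → encPoly (P i)))))

Decides : PR 1 → (Instance → Set) → Set
Decides c Q = (I : Instance) →
  (Q I → Eval c (encInstance I ∷ []) 1) × (¬ Q I → Eval c (encInstance I ∷ []) 0)

module Submission where

-- A loop with constant coordinates in which one further coordinate counts the steps n and another one is 2^n
-- runs forever on x iff finitely many polynomial inequalities P(x, n, 2^n) > 0 hold for all n. Such inequalities
-- express b = 2^a: take 1 + (n - a)²(b² + 4^n) - (b - 2^n)² > 0. That the counters start at n = 0 is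
-- forced by integrality: a coordinate multiplied by 1/2 and one multiplied by 2 have an invariant product, which is
-- required to be 1. So non-termination expresses every system of polynomial equations and powers of 2 over ℕ.
--
-- Such systems define the graph of every partial recursive function. Sequences are coded by their digits in a
-- base 2^w; digitwise constraints reduce to the bitwise order, which by Lucas' theorem is the oddness of a
-- binomial coefficient, itself a digit of (1 + u)^b, a remainder of a power of 2. Recursion and minimisation are
-- run as loops in parallel on all digits, an iteration being a multiplication by a power of the base.
--
-- A decision procedure c is refuted by the loop that runs forever iff c answers 1 on this very loop; the
-- numbers needed to compute its code are passed to it as values of four of its coordinates.

open import Defs
open import Data.Product using (Σ)
open import Relation.Nullary using (¬_)

open import Data.Bool using (Bool; true; false; _xor_; _∧_)
open import Data.Bool.Properties using (xor-identityʳ)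
open import Data.Empty using (⊥-elim)
open import Data.Fin using (Fin; toℕ; splitAt; join; _↑ˡ_; _↑ʳ_) renaming (zero to fzero; suc to fsuc)
open import Data.Fin.Patterns
open import Data.Fin.Properties using (any?; toℕ-↑ˡ; splitAt-↑ˡ; splitAt-↑ʳ)
open import Data.Integer as ℤ using (ℤ; -[1+_]; 0ℤ)
import Data.Integer.Properties as ℤ
open import Data.Integer.Tactic.RingSolver using () renaming (solve-∀ to solveℤ-∀)
open import Data.List as List using (List; []; _∷_; _++_)
open import Data.List.Membership.Propositional.Properties using (∈-allFin)
open import Data.List.Relation.Unary.All as All using (All; []; _∷_)
import Data.List.Relation.Unary.All.Properties as All
open import Data.Nat
import Data.Nat.Coprimality as Coprime
open import Data.Nat.Divisibility using (∣-refl; n∣m*n)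
open import Data.Nat.DivMod
open import Data.Nat.Induction using (<-rec)
open import Data.Nat.Properties
open import Data.Nat.Tactic.RingSolver using (solve-∀)
open import Data.Product using (_×_; _,_; proj₁; proj₂)
open import Data.Rational as ℚ using (ℚ; mkℚ; 0ℚ; 1ℚ; ½)
import Data.Rational.Properties as ℚ
open import Data.Sum using (_⊎_; inj₁; inj₂) renaming (map to map⊎; [_,_]′ to [_,_])
open import Data.Vec as Vec using (Vec; []; _∷_; lookup; tabulate; map)
open import Data.Vec.Properties using (tabulate-∘; tabulate∘lookup)
open import Function using (_∘_)
open import Relation.Binary.Definitions using (tri<; tri≈; tri>)
open import Relation.Binary.PropositionalEquality hiding ([_])
open import Relation.Nullary using (yes; no)

-- Binomial coefficients modulo 2

-- The usual obstacle in such encodings is a bounded universal quantifier: a run asserts something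
-- at each of its moments. It is avoided because a relation is asserted at all marked digit
-- positions simultaneously, by conditions on whole numbers; the body of a loop is the same
-- translation applied to another mask, so nested loops unfold by recursion on the program. Carries
-- would mix positions, hence the base `2K + 2` with registers at most `K`: two registers still add
-- up to one digit.
--
-- The argument is constructive, so an input that codes no solution must yield an actual halting
-- time. Each guard is tested at one moment only, the value of the exponent for a power of 2 and 0
-- otherwise; these finitely many tests either find a halting time or exhibit a solution.
--
-- The diagonal is not circular: the code of the loop is an expression in four inputs that is fixed
-- before the formula is known. The inputs occur in the loop only as constants of four guards, so
-- the sizes and the codes of everything else do not depend on them and can be supplied as their
-- values.

oddC : ℕ → ℕ → Bool
oddC zero    zero    = true
oddC zero    (suc a) = false
oddC (suc b) zero    = true
oddC (suc b) (suc a) = oddC b a xor oddC b (suc a)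

-- By Lucas' theorem modulo 2 this says that every binary digit of a is at most that of b.
infix 4 _⊑_
_⊑_ : ℕ → ℕ → Set
a ⊑ b = oddC b a ≡ true

oddC-zero : ∀ b → oddC b 0 ≡ true
oddC-zero zero    = refl
oddC-zero (suc b) = refl

oddC-< : ∀ {b a} → b < a → oddC b a ≡ false
oddC-< {zero}  {suc a} _         = refl
oddC-< {suc b} {suc a} (s≤s b<a) =
  cong₂ _xor_ (oddC-< b<a) (oddC-< (m<n⇒m<1+n b<a))

⊑⇒≤ : ∀ {a b} → a ⊑ b → a ≤ b
⊑⇒≤ {a} {b} p with a ≤? b
... | yes a≤b = a≤b
... | no a≰b with trans (sym p) (oddC-< (≰⇒> a≰b))
... | ()

-- Pascal's rule twice: the middle term occurs twice and cancels, as in (1 + x)² = 1 + x² modulo 2.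
-- This is the source of Lucas' theorem.
oddC-2+2+ : ∀ b a → oddC (2 + b) (2 + a) ≡ oddC b a xor oddC b (2 + a)
oddC-2+2+ b a = cancel (oddC b a) (oddC b (suc a)) (oddC b (2 + a))
  where
  cancel : ∀ x y z → (x xor y) xor (y xor z) ≡ x xor z
  cancel true  true  z = refl
  cancel true  false z = refl
  cancel false true  true = refl
  cancel false true  false = refl
  cancel false false z = refl

-- Doubling by constructors, so that `oddC` computes on doubled successors.
dbl : ℕ → ℕ
dbl zero    = zero
dbl (suc n) = suc (suc (dbl n))

oddC-dbl-dbl : ∀ b a → oddC (dbl b) (dbl a) ≡ oddC b a
oddC-dbl-dbl zero    zero    = refl
oddC-dbl-dbl zero    (suc a) = refl
oddC-dbl-dbl (suc b) zero    = refl
oddC-dbl-dbl (suc b) (suc a) = trans (oddC-2+2+ (dbl b) (dbl a))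
  (cong₂ _xor_ (oddC-dbl-dbl b a) (oddC-dbl-dbl b (suc a)))

oddC-dbl-odd : ∀ b a → oddC (dbl b) (suc (dbl a)) ≡ false
oddC-dbl-odd zero    a       = refl
oddC-dbl-odd (suc b) zero    rewrite oddC-zero (dbl b) | oddC-dbl-odd b zero = refl
oddC-dbl-odd (suc b) (suc a) = trans (oddC-2+2+ (dbl b) (suc (dbl a)))
  (cong₂ _xor_ (oddC-dbl-odd b a) (oddC-dbl-odd b (suc a)))

oddC-odd-dbl : ∀ b a → oddC (suc (dbl b)) (dbl a) ≡ oddC b a
oddC-odd-dbl b zero    = sym (oddC-zero b)
oddC-odd-dbl b (suc a) =
  trans (cong (_xor oddC (dbl b) (dbl (suc a))) (oddC-dbl-odd b a)) (oddC-dbl-dbl b (suc a))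

oddC-odd-odd : ∀ b a → oddC (suc (dbl b)) (suc (dbl a)) ≡ oddC b a
oddC-odd-odd b a =
  trans (cong₂ _xor_ (oddC-dbl-dbl b a) (oddC-dbl-odd b a)) (xor-identityʳ _)

dbl≡ : ∀ n → dbl n ≡ n + n
dbl≡ zero    = refl
dbl≡ (suc n) = cong suc (trans (cong suc (dbl≡ n)) (sym (+-suc n n)))

data Halves : ℕ → Set where
  even : ∀ n → Halves (dbl n)
  odd  : ∀ n → Halves (suc (dbl n))

halves : ∀ n → Halves n
halves zero = even zero
halves (suc n) with halves n
... | even m = odd m
... | odd m  = even (suc m)

dbl-cancel-< : ∀ m n → dbl m < dbl n → m < n
dbl-cancel-< m       zero    ()
dbl-cancel-< zero    (suc n) _ = s≤s z≤n
dbl-cancel-< (suc m) (suc n) (s≤s (s≤s p)) = s≤s (dbl-cancel-< m n p)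

odd-cancel-< : ∀ m n → suc (dbl m) < dbl n → m < n
odd-cancel-< m n p = dbl-cancel-< m n (<-trans (n<1+n _) p)

dbl-injective : ∀ m n → dbl m ≡ dbl n → m ≡ n
dbl-injective zero    zero    _ = refl
dbl-injective (suc m) (suc n) p = cong suc (dbl-injective m n (suc-injective (suc-injective p)))

odd<dbl : ∀ {m n} → m < n → suc (dbl m) < dbl n
odd<dbl {zero}  (s≤s z≤n)       = s≤s (s≤s z≤n)
odd<dbl {suc m} (s≤s l@(s≤s _)) = s≤s (s≤s (odd<dbl l))

dbl-2^ : ∀ w → 2 ^ suc w ≡ dbl (2 ^ w)
dbl-2^ w = trans (cong (2 ^ w +_) (+-identityʳ _)) (sym (dbl≡ (2 ^ w)))

dbl-block : ∀ w x y → dbl x + dbl (2 ^ w) * y ≡ dbl (x + 2 ^ w * y)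
dbl-block w x y = begin
  dbl x + dbl (2 ^ w) * y                 ≡⟨ cong₂ (λ p q → p + q * y) (dbl≡ x) (dbl≡ (2 ^ w)) ⟩
  (x + x) + (2 ^ w + 2 ^ w) * y           ≡⟨ ring x (2 ^ w) y ⟩
  (x + 2 ^ w * y) + (x + 2 ^ w * y)       ≡⟨ sym (dbl≡ _) ⟩
  dbl (x + 2 ^ w * y)                     ∎
  where
  open ≡-Reasoning
  ring : ∀ x p y → (x + x) + (p + p) * y ≡ (x + p * y) + (x + p * y)
  ring = solve-∀

-- Lucas' theorem for a block of `w` binary digits: each round strips the lowest binary digit of
-- `b₀` and `a₀`. A digit 1 of `a₀` over a digit 0 of `b₀` makes both sides false.
oddC-block : ∀ w {b₀ a₀} b₁ a₁ → b₀ < 2 ^ w → a₀ < 2 ^ w →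
  oddC (b₀ + 2 ^ w * b₁) (a₀ + 2 ^ w * a₁) ≡ oddC b₀ a₀ ∧ oddC b₁ a₁
oddC-block zero {zero}  {zero}  b₁ a₁ _ _ = cong₂ oddC (*-identityˡ b₁) (*-identityˡ a₁)
oddC-block zero {suc _} {_}     b₁ a₁ (s≤s ()) _
oddC-block zero {zero}  {suc _} b₁ a₁ _ (s≤s ())
oddC-block (suc w) {b₀} {a₀} b₁ a₁ p q rewrite dbl-2^ w with halves b₀ | halves a₀
... | even b | even a
  rewrite dbl-block w b b₁ | dbl-block w a a₁
        | oddC-dbl-dbl (b + 2 ^ w * b₁) (a + 2 ^ w * a₁) | oddC-dbl-dbl b a
  = oddC-block w b₁ a₁ (dbl-cancel-< b _ p) (dbl-cancel-< a _ q)
... | even b | odd a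
  rewrite dbl-block w b b₁ | dbl-block w a a₁
        | oddC-dbl-odd (b + 2 ^ w * b₁) (a + 2 ^ w * a₁) | oddC-dbl-odd b a
  = refl
... | odd b | even a
  rewrite dbl-block w b b₁ | dbl-block w a a₁
        | oddC-odd-dbl (b + 2 ^ w * b₁) (a + 2 ^ w * a₁) | oddC-odd-dbl b a
  = oddC-block w b₁ a₁ (odd-cancel-< b _ p) (dbl-cancel-< a _ q)
... | odd b | odd a
  rewrite dbl-block w b b₁ | dbl-block w a a₁
        | oddC-odd-odd (b + 2 ^ w * b₁) (a + 2 ^ w * a₁) | oddC-odd-odd b a
  = oddC-block w b₁ a₁ (odd-cancel-< b _ p) (odd-cancel-< a _ q)

-- All binary digits of 2^w - 1 are 1, so domination by it is merely a bound. Numerical bounds on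
-- digits thereby become bitwise conditions.
⊑-ones : ∀ w {k a} → suc k ≡ 2 ^ w → a ≤ k → a ⊑ k
⊑-ones zero {zero} {zero} _ _ = refl
⊑-ones (suc w) {k} {a} e a≤k with halves k | halves a | trans e (dbl-2^ w)
... | even k | _ | e′ = ⊥-elim (odd≢dbl _ _ e′)
  where
  odd≢dbl : ∀ m n → suc (dbl m) ≢ dbl n
  odd≢dbl zero    (suc zero) ()
  odd≢dbl (suc m) (suc n) p = odd≢dbl m n (suc-injective (suc-injective p))
... | odd k | even a | e′ =
  trans (oddC-odd-dbl k a) (⊑-ones w (dbl-injective (suc k) _ e′) (≮⇒≥ λ l → <⇒≱ (odd<dbl l) a≤k))
... | odd k | odd a | e′ =
  trans (oddC-odd-odd k a)
        (⊑-ones w (dbl-injective (suc k) _ e′) (≮⇒≥ λ l → <⇒≱ (m<n⇒m<1+n (odd<dbl l)) a≤k))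

-- Digits

shift : ℕ → (ℕ → ℕ) → ℕ → ℕ
shift zero    x t       = x t
shift (suc T) x zero    = 0
shift (suc T) x (suc t) = shift T x t

shift-view : ∀ T t → (t < T × (∀ x → shift T x t ≡ 0)) ⊎
                     (Σ ℕ λ t′ → t ≡ T + t′ × (∀ x → shift T x t ≡ x t′))
shift-view zero    t    = inj₂ (t , refl , λ _ → refl)
shift-view (suc T) zero = inj₁ (s≤s z≤n , λ _ → refl)
shift-view (suc T) (suc t) with shift-view T t
... | inj₁ (l , z)      = inj₁ (s≤s l , z)
... | inj₂ (t′ , e , z) = inj₂ (t′ , cong suc e , z)

shift-+ : ∀ T x t → shift T x (T + t) ≡ x t
shift-+ zero    x t = refl
shift-+ (suc T) x t = shift-+ T x t

module Digits (K : ℕ) where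

  -- Twice `K + 1`: the sum of two digits at most `K` produces no carry, and when `B` is a power of
  -- 2, `K` consists of binary ones only.
  B : ℕ
  B = 2 + (K + K)

  dig : ℕ → ℕ → ℕ
  dig X zero    = X % B
  dig X (suc t) = dig (X / B) t

  dig<B : ∀ X t → dig X t < B
  dig<B X zero    = m%n<n X B
  dig<B X (suc t) = dig<B (X / B) t

  %-low : ∀ {r} q → r < B → (r + q * B) % B ≡ r
  %-low {r} q r<B = trans ([m+kn]%n≡m%n r q B) (m<n⇒m%n≡m r<B)

  /-low : ∀ {r} q → r < B → (r + q * B) / B ≡ q
  /-low {r} q r<B = begin
    (r + q * B) / B     ≡⟨ +-distrib-/-∣ʳ r (n∣m*n q) ⟩
    r / B + q * B / B   ≡⟨ cong₂ _+_ (m<n⇒m/n≡0 r<B) (m*n/n≡m q B) ⟩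
    q                   ∎
    where open ≡-Reasoning

  split : ∀ X → X ≡ X % B + (X / B) * B
  split X = m≡m%n+[m/n]*n X B

  +-split : ∀ X Y → X + Y ≡ (X % B + Y % B) + (X / B + Y / B) * B
  +-split X Y = trans (cong₂ _+_ (split X) (split Y)) (ring (X % B) (X / B) (Y % B) (Y / B) B)
    where
    ring : ∀ a b c d e → (a + b * e) + (c + d * e) ≡ (a + c) + (b + d) * e
    ring = solve-∀

  dig-+ : ∀ X Y → (∀ t → dig X t + dig Y t < B) → ∀ t → dig (X + Y) t ≡ dig X t + dig Y t
  dig-+ X Y l zero = trans (cong (_% B) (+-split X Y)) (%-low (X / B + Y / B) (l 0))
  dig-+ X Y l (suc t) = trans
    (cong (λ z → dig z t) (trans (cong (_/ B) (+-split X Y)) (/-low (X / B + Y / B) (l 0))))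
    (dig-+ (X / B) (Y / B) (l ∘ suc) t)

  -- If no digit of a summand exceeds that of the sum, the addition has no carries.
  dig-+-≤ : ∀ X Y → (∀ t → dig X t ≤ dig (X + Y) t) → ∀ t → dig (X + Y) t ≡ dig X t + dig Y t
  dig-+-≤ X Y l = go
    where
    r = X % B + Y % B
    q = X / B + Y / B
    nocarry : r < B
    nocarry with r <? B
    ... | yes p = p
    ... | no ¬p = ⊥-elim (<⇒≱ small (l 0))
      where
      o = r ∸ B
      r≡ : r ≡ o + B
      r≡ = sym (m∸n+n≡m (≮⇒≥ ¬p))
      o<x : o < X % B
      o<x = +-cancelʳ-< B o (X % B) (subst (_< X % B + B) r≡ (+-monoʳ-< (X % B) (m%n<n Y B)))
      sum≡ : X + Y ≡ o + suc q * B
      sum≡ = trans (+-split X Y) (trans (cong (_+ q * B) r≡) (+-assoc o B (q * B)))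
      small : (X + Y) % B < X % B
      small = subst (_< X % B) (sym (trans (cong (_% B) sum≡) (%-low (suc q) (<-trans o<x (m%n<n X B))))) o<x
    quot : (X + Y) / B ≡ q
    quot = trans (cong (_/ B) (+-split X Y)) (/-low q nocarry)
    go : ∀ t → dig (X + Y) t ≡ dig X t + dig Y t
    go zero = trans (cong (_% B) (+-split X Y)) (%-low q nocarry)
    go (suc t) = trans (cong (λ z → dig z t) quot)
      (dig-+-≤ (X / B) (Y / B) (λ s → subst (λ z → dig (X / B) s ≤ dig z s) quot (l (suc s))) t)

  /-≤ : ∀ {X n} → X ≤ suc n → X / B ≤ n
  /-≤ {zero} {n} _ = subst (_≤ n) (sym (0/n≡0 B)) z≤n
  /-≤ {suc X} l = s≤s⁻¹ (≤-trans (m/n<m (suc X) B (s≤s (s≤s z≤n))) l)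

  dig-ext : ∀ {X Y} → (∀ t → dig X t ≡ dig Y t) → X ≡ Y
  dig-ext {X} {Y} = go (X ⊔ Y) (m≤m⊔n X Y) (m≤n⊔m X Y)
    where
    go : ∀ n {X Y} → X ≤ n → Y ≤ n → (∀ t → dig X t ≡ dig Y t) → X ≡ Y
    go zero    z≤n z≤n e = refl
    go (suc n) {X} {Y} p q e = begin
      X                    ≡⟨ split X ⟩
      X % B + (X / B) * B  ≡⟨ cong₂ (λ u v → u + v * B) (e 0) (go n (/-≤ p) (/-≤ q) (e ∘ suc)) ⟩
      Y % B + (Y / B) * B  ≡⟨ split Y ⟨
      Y                    ∎
      where open ≡-Reasoning

  dig-0 : ∀ t → dig 0 t ≡ 0
  dig-0 zero    = refl
  dig-0 (suc t) = trans (cong (λ z → dig z t) (0/n≡0 B)) (dig-0 t)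

  dig-≥ : ∀ X t → X ≤ t → dig X t ≡ 0
  dig-≥ X       zero    z≤n = refl
  dig-≥ X       (suc t) l   = dig-≥ (X / B) t (/-≤ l)

  dig-small-0 : ∀ {X} → X < B → dig X 0 ≡ X
  dig-small-0 = m<n⇒m%n≡m

  dig-small-suc : ∀ {X} → X < B → ∀ t → dig X (suc t) ≡ 0
  dig-small-suc l t = trans (cong (λ z → dig z t) (m<n⇒m/n≡0 l)) (dig-0 t)

  dig-shift : ∀ T X t → dig (B ^ T * X) t ≡ shift T (dig X) t
  dig-shift zero    X t = cong (λ z → dig z t) (*-identityˡ X)
  dig-shift (suc T) X t = trans (cong (λ z → dig z t) rot) (lemma t)
    where
    rot : B ^ suc T * X ≡ 0 + (B ^ T * X) * B
    rot = trans (*-assoc B (B ^ T) X) (*-comm B (B ^ T * X))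
    lemma : ∀ t → dig (0 + (B ^ T * X) * B) t ≡ shift (suc T) (dig X) t
    lemma zero    = %-low (B ^ T * X) (s≤s z≤n)
    lemma (suc t) = trans (cong (λ z → dig z t) (/-low (B ^ T * X) (s≤s z≤n))) (dig-shift T X t)

  num : (ℕ → ℕ) → ℕ → ℕ
  num x zero    = 0
  num x (suc τ) = x 0 + num (x ∘ suc) τ * B

  dig-num : ∀ x τ → (∀ t → x t < B) → (∀ t → τ ≤ t → x t ≡ 0) → ∀ t → dig (num x τ) t ≡ x t
  dig-num x zero    b z t       = trans (dig-0 t) (sym (z t z≤n))
  dig-num x (suc τ) b z zero    = %-low (num (x ∘ suc) τ) (b 0)
  dig-num x (suc τ) b z (suc t) = trans
    (cong (λ y → dig y t) (/-low (num (x ∘ suc) τ) (b 0)))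
    (dig-num (x ∘ suc) τ (b ∘ suc) (λ t l → z (suc t) (s≤s l)) t)

  Mask : ℕ → Set
  Mask M = ∀ t → dig M t ≤ 1

  dig-K* : ∀ M → Mask M → ∀ t → dig (K * M) t ≡ K * dig M t
  dig-K* M mask t = lemma t
    where
    *-split : K * M ≡ K * (M % B) + (K * (M / B)) * B
    *-split = trans (cong (K *_) (split M))
      (trans (*-distribˡ-+ K (M % B) (M / B * B)) (cong (K * (M % B) +_) (sym (*-assoc K (M / B) B))))
    low : K * (M % B) < B
    low = ≤-<-trans (*-monoʳ-≤ K (mask 0))
            (subst (_< B) (sym (*-identityʳ K)) (m<n⇒m<1+n (s≤s (m≤m+n K K))))
    lemma : ∀ t → dig (K * M) t ≡ K * dig M t
    lemma zero    = trans (cong (_% B) *-split) (%-low (K * (M / B)) low)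
    lemma (suc t) = trans (cong (λ z → dig z t) (trans (cong (_/ B) *-split) (/-low (K * (M / B)) low)))
      (dig-K* (M / B) (mask ∘ suc) t)

  module _ (w : ℕ) (2^w≡B : 2 ^ w ≡ B) where

    oddC-split : ∀ Y X → oddC Y X ≡ oddC (Y % B) (X % B) ∧ oddC (Y / B) (X / B)
    oddC-split Y X = begin
      oddC Y X
        ≡⟨ cong₂ oddC (split′ Y) (split′ X) ⟩
      oddC (Y % B + 2 ^ w * (Y / B)) (X % B + 2 ^ w * (X / B))
        ≡⟨ oddC-block w (Y / B) (X / B) (low Y) (low X) ⟩
      oddC (Y % B) (X % B) ∧ oddC (Y / B) (X / B) ∎
      where
      open ≡-Reasoning
      split′ : ∀ C → C ≡ C % B + 2 ^ w * (C / B)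
      split′ C = trans (split C)
        (cong (C % B +_) (trans (*-comm (C / B) B) (cong (_* (C / B)) (sym 2^w≡B))))
      low : ∀ C → C % B < 2 ^ w
      low C = subst (C % B <_) (sym 2^w≡B) (m%n<n C B)

    ∧-split : ∀ x {y} → x ∧ y ≡ true → x ≡ true × y ≡ true
    ∧-split true {true} _ = refl , refl

    ⊑⇒dig-⊑ : ∀ X Y → X ⊑ Y → ∀ t → dig X t ⊑ dig Y t
    ⊑⇒dig-⊑ X Y p t with ∧-split (oddC (Y % B) (X % B)) (trans (sym (oddC-split Y X)) p)
    ⊑⇒dig-⊑ X Y p zero    | h , _ = h
    ⊑⇒dig-⊑ X Y p (suc t) | _ , h = ⊑⇒dig-⊑ (X / B) (Y / B) h t

    dig-⊑⇒⊑ : ∀ {X Y} → (∀ t → dig X t ⊑ dig Y t) → X ⊑ Y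
    dig-⊑⇒⊑ {X} {Y} = go (X ⊔ Y) (m≤m⊔n X Y) (m≤n⊔m X Y)
      where
      go : ∀ n {X Y} → X ≤ n → Y ≤ n → (∀ t → dig X t ⊑ dig Y t) → X ⊑ Y
      go zero    z≤n z≤n h = refl
      go (suc n) {X} {Y} p q h =
        trans (oddC-split Y X) (cong₂ _∧_ (h 0) (go n (/-≤ p) (/-≤ q) (h ∘ suc)))

    ⊑K⇒dig-≤ : ∀ M X → Mask M → X ⊑ K * M → ∀ t → dig X t ≤ K * dig M t
    ⊑K⇒dig-≤ M X mask h t =
      subst (dig X t ≤_) (dig-K* M mask t) (⊑⇒≤ (⊑⇒dig-⊑ X (K * M) h t))

    -- The number `K * M` has the digit `K` at the marked positions and 0 elsewhere. Since `K + 1`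
    -- is half of the base 2^w, `K` is all ones and `⊑-ones` applies at each marked position.
    dig-≤⇒⊑K : ∀ M X → Mask M → (∀ t → dig X t ≤ K * dig M t) → X ⊑ K * M
    dig-≤⇒⊑K M X mask h = dig-⊑⇒⊑ λ t → subst (dig X t ⊑_) (sym (dig-K* M mask t)) (lemma (mask t) (h t))
      where
      half : ∀ w → 2 ^ w ≡ B → Σ ℕ λ v → suc K ≡ 2 ^ v
      half zero    ()
      half (suc v) e = v , dbl-injective (suc K) (2 ^ v)
        (trans (cong (λ z → suc (suc z)) (dbl≡ K)) (trans (sym e) (dbl-2^ v)))
      lemma : ∀ {m x} → m ≤ 1 → x ≤ K * m → x ⊑ K * m
      lemma {zero}        _  l with K * 0 | *-zeroʳ K
      lemma {zero} {zero} _  l | .0 | refl = refl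
      lemma {suc zero}    _  l rewrite *-identityʳ K = ⊑-ones (proj₁ (half w 2^w≡B)) (proj₂ (half w 2^w≡B)) l
      lemma {suc (suc _)} (s≤s ())

-- Exponential Diophantine definition of ⊑

binom : ℕ → ℕ → ℕ
binom zero    zero    = 1
binom zero    (suc a) = 0
binom (suc b) zero    = 1
binom (suc b) (suc a) = binom b a + binom b (suc a)

bit : Bool → ℕ
bit false = 0
bit true  = 1

binom-parity : ∀ b a → Σ ℕ λ c → binom b a ≡ bit (oddC b a) + (c + c)
binom-parity zero    zero    = 0 , refl
binom-parity zero    (suc a) = 0 , refl
binom-parity (suc b) zero    = 0 , refl
binom-parity (suc b) (suc a) with binom-parity b a | binom-parity b (suc a)
... | c , p | d , q = sum-parity (oddC b a) (oddC b (suc a)) p q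
  where
  ring : ∀ x y c d → (x + (c + c)) + (y + (d + d)) ≡ (x + y) + ((c + d) + (c + d))
  ring = solve-∀
  ring₁ : ∀ c d → (1 + (c + c)) + (1 + (d + d)) ≡ (1 + c + d) + (1 + c + d)
  ring₁ = solve-∀
  sum-parity : ∀ s t {x y} → x ≡ bit s + (c + c) → y ≡ bit t + (d + d) →
        Σ ℕ λ e → x + y ≡ bit (s xor t) + (e + e)
  sum-parity true  true  p q = 1 + c + d , trans (cong₂ _+_ p q) (ring₁ c d)
  sum-parity true  false p q = c + d , trans (cong₂ _+_ p q) (ring 1 0 c d)
  sum-parity false true  p q = c + d , trans (cong₂ _+_ p q) (ring 0 1 c d)
  sum-parity false false p q = c + d , trans (cong₂ _+_ p q) (ring 0 0 c d)

binom-< : ∀ b a → binom b a < 2 ^ suc b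
binom-< b a = ≤-<-trans (bound b a) (^-monoʳ-< 2 (s≤s (s≤s z≤n)) (n<1+n b))
  where
  bound : ∀ b a → binom b a ≤ 2 ^ b
  bound zero    zero    = s≤s z≤n
  bound zero    (suc a) = z≤n
  bound (suc b) zero    = m^n>0 2 (suc b)
  bound (suc b) (suc a) = subst (binom b a + binom b (suc a) ≤_) (cong (2 ^ b +_) (sym (+-identityʳ _)))
                            (+-mono-≤ (bound b a) (bound b (suc a)))

-- The quotient of (1 + u)^b by u^a when the binomial coefficients are less than u.
upper : ℕ → ℕ → ℕ → ℕ
upper u zero    zero    = 1
upper u zero    (suc a) = 0
upper u (suc b) zero    = (1 + u) * upper u b zero
upper u (suc b) (suc a) = upper u b a + upper u b (suc a)

upper-step : ∀ u b a → upper u b a ≡ binom b a + u * upper u b (suc a)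
upper-step u zero    zero    = cong suc (sym (*-zeroʳ u))
upper-step u zero    (suc a) = sym (*-zeroʳ u)
upper-step u (suc b) zero    = begin
  (1 + u) * upper u b 0                   ≡⟨ cong (_+ u * upper u b 0) (upper-step u b 0) ⟩
  (binom b 0 + u * upper u b 1) + u * upper u b 0  ≡⟨ cong (λ z → (z + u * upper u b 1) + u * upper u b 0) (binom-0 b) ⟩
  (1 + u * upper u b 1) + u * upper u b 0  ≡⟨ ring u (upper u b 1) (upper u b 0) ⟩
  1 + u * (upper u b 0 + upper u b 1)     ∎
  where
  open ≡-Reasoning
  binom-0 : ∀ b → binom b 0 ≡ 1
  binom-0 zero    = refl
  binom-0 (suc b) = refl
  ring : ∀ u x y → (1 + u * x) + u * y ≡ 1 + u * (y + x)
  ring = solve-∀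
upper-step u (suc b) (suc a) = trans (cong₂ _+_ (upper-step u b a) (upper-step u b (suc a)))
  (ring u (binom b a) (binom b (suc a)) (upper u b (suc a)) (upper u b (suc (suc a))))
  where
  ring : ∀ u x y z t → (x + u * z) + (y + u * t) ≡ (x + y) + u * (z + t)
  ring = solve-∀

-- Division of (1 + u)^b by u^a: binomial coefficients below `u` are the base-`u` digits of the
-- power, so those before position `a` form a remainder.
pow-expand : ∀ u b → (∀ a → binom b a < u) → ∀ a →
  Σ ℕ λ l → l < u ^ a × (1 + u) ^ b ≡ l + u ^ a * upper u b a
pow-expand u b small zero = 0 , s≤s z≤n , trans (pow≡ b) (sym (*-identityˡ (upper u b 0)))
  where
  pow≡ : ∀ b → (1 + u) ^ b ≡ upper u b 0
  pow≡ zero    = refl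
  pow≡ (suc b) = cong ((1 + u) *_) (pow≡ b)
pow-expand u b small (suc a) with pow-expand u b small a
... | l , l< , e = l + u ^ a * binom b a , bound , (begin
    (1 + u) ^ b                                             ≡⟨ e ⟩
    l + u ^ a * upper u b a                                 ≡⟨ cong (λ z → l + u ^ a * z) (upper-step u b a) ⟩
    l + u ^ a * (binom b a + u * upper u b (suc a))         ≡⟨ ring l (u ^ a) (binom b a) u (upper u b (suc a)) ⟩
    (l + u ^ a * binom b a) + u ^ suc a * upper u b (suc a) ∎)
  where
  open ≡-Reasoning
  ring : ∀ l p c u h → l + p * (c + u * h) ≡ (l + p * c) + (u * p) * h
  ring = solve-∀
  bound : l + u ^ a * binom b a < u ^ suc a
  bound = <-≤-trans (+-monoˡ-< (u ^ a * binom b a) l<)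
    (subst₂ _≤_ (*-suc (u ^ a) (binom b a)) (*-comm (u ^ a) u) (*-monoʳ-≤ (u ^ a) (small a)))

quot-unique : ∀ {D l l′} x x′ → l < D → l′ < D → l + D * x ≡ l′ + D * x′ → x ≡ x′
quot-unique {D} zero    zero     p q e = refl
quot-unique {D} {l} {l′} zero (suc x′) p q e = ⊥-elim (<⇒≱ p
  (subst (D ≤_) (trans (sym e) (trans (cong (l +_) (*-zeroʳ D)) (+-identityʳ l)))
    (≤-trans (subst (D ≤_) (sym (*-suc D x′)) (m≤m+n D (D * x′))) (m≤n+m (D * suc x′) l′))))
quot-unique {D} {l} {l′} (suc x) zero p q e = ⊥-elim (<⇒≱ q
  (subst (D ≤_) (trans e (trans (cong (l′ +_) (*-zeroʳ D)) (+-identityʳ l′)))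
    (≤-trans (subst (D ≤_) (sym (*-suc D x)) (m≤m+n D (D * x))) (m≤n+m (D * suc x) l))))
quot-unique {D} {l} {l′} (suc x) (suc x′) p q e = cong suc (quot-unique x x′ p q
  (+-cancelˡ-≡ D _ _ (trans (sym (ring l D x)) (trans e (ring l′ D x′)))))
  where
  ring : ∀ l D x → l + D * suc x ≡ D + (l + D * x)
  ring = solve-∀

rem-unique : ∀ {D l l′} x x′ → l < D → l′ < D → l + D * x ≡ l′ + D * x′ → l ≡ l′
rem-unique {D} {l} {l′} x x′ p q e = +-cancelʳ-≡ (D * x) l l′
  (trans e (cong (λ z → l′ + D * z) (sym (quot-unique x x′ p q e))))

-- Modulo `r` the base `s + r` may be replaced by `s`. With `s + r` a power of 2, this reduces
-- powers of `1 + u` to powers of 2.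
pow-mod : ∀ s r n → Σ ℕ λ q → (s + r) ^ n ≡ s ^ n + r * q
pow-mod s r zero = 0 , cong suc (sym (*-zeroʳ r))
pow-mod s r (suc n) with pow-mod s r n
... | q , e = s ^ n + s * q + r * q , trans (cong ((s + r) *_) e) (ring s r (s ^ n) q)
  where
  ring : ∀ s r p q → (s + r) * (p + r * q) ≡ s * p + r * (p + s * q + r * q)
  ring = solve-∀

-- With 1 + u ≤ 2^(b+2), both (1 + u)^b and 1 + u are at most 2^((b+2)(b+1)); the final `+ 1` leaves
-- room for their sum. The factor `b + 1` instead of `b` covers `b = 0`.
maskDegree : ℕ → ℕ
maskDegree b = (b + 2) * (b + 1) + 1

-- With u = 2^(b+1), the digit of (1 + u)^b at u^a is the binomial coefficient, here of the form
-- 1 + 2c; and (1 + u)^b is the remainder of 2^(db) modulo 2^d - (1 + u).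
record MaskWitness (a b u U P Q q h c l : ℕ) : Set where
  constructor maskWitness
  field
    u≡ : u ≡ 2 ^ (b + 1)
    U≡ : U ≡ 2 ^ ((b + 1) * a)
    P≡ : P ≡ 2 ^ maskDegree b
    Q≡ : Q ≡ 2 ^ (maskDegree b * b)
    l< : l < U
    c< : 1 + (c + c) < u
    N< : (l + U * ((1 + (c + c)) + u * h)) + (1 + u) < P
    Q≡N : Q + q * (1 + u) ≡ (l + U * ((1 + (c + c)) + u * h)) + q * P

module Mask (b : ℕ) where
  private
    u = 2 ^ (b + 1)
    s = 1 + u
    P = 2 ^ maskDegree b

  binom<u : ∀ a → binom b a < u
  binom<u a = subst (λ z → binom b a < 2 ^ z) (sym (+-comm b 1)) (binom-< b a)

  pow-small : s ^ b + s < P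
  pow-small = subst (s ^ b + s <_) P≡ (+-mono-≤-< pow≤ s<)
    where
    s≤ : s ≤ 2 ^ (b + 2)
    s≤ = subst (s ≤_) (trans (cong (u +_) (sym (+-identityʳ u))) (cong (2 ^_) (sym (+-suc b 1))))
           (+-monoˡ-≤ u (m^n>0 2 (b + 1)))
    pow≤ : s ^ b ≤ 2 ^ ((b + 2) * (b + 1))
    pow≤ = ≤-trans (^-monoˡ-≤ b s≤) (≤-trans (≤-reflexive (^-*-assoc 2 (b + 2) b))
             (^-monoʳ-≤ 2 (*-monoʳ-≤ (b + 2) (m≤m+n b 1))))
    s<′ : s < 2 ^ (b + 2)
    s<′ = subst (s <_) (trans (cong (u +_) (sym (+-identityʳ u))) (cong (2 ^_) (sym (+-suc b 1))))
           (+-monoˡ-< u (≤-trans (s≤s (s≤s z≤n)) (^-monoʳ-≤ 2 (m≤n+m 1 b))))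
    s< : s < 2 ^ ((b + 2) * (b + 1))
    s< = <-≤-trans s<′ (^-monoʳ-≤ 2 (≤-trans (≤-reflexive (sym (*-identityʳ (b + 2))))
           (*-monoʳ-≤ (b + 2) (m≤n+m 1 b))))
    P≡ : 2 ^ ((b + 2) * (b + 1)) + 2 ^ ((b + 2) * (b + 1)) ≡ P
    P≡ = trans (cong (2 ^ ((b + 2) * (b + 1)) +_) (sym (+-identityʳ _)))
               (cong (2 ^_) (+-comm 1 ((b + 2) * (b + 1))))

  private
    r = P ∸ s

  s+r≡P : s + r ≡ P
  s+r≡P = m+[n∸m]≡n (<⇒≤ (≤-<-trans (m≤n+m s (s ^ b)) pow-small))

  pow<r : s ^ b < r
  pow<r = +-cancelʳ-< s (s ^ b) r (subst (s ^ b + s <_) (trans (sym s+r≡P) (+-comm s r)) pow-small)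

  Q≡pow : 2 ^ (maskDegree b * b) ≡ (s + r) ^ b
  Q≡pow = trans (sym (^-*-assoc 2 (maskDegree b) b)) (cong (_^ b) (sym s+r≡P))

  shuffle : ∀ x q s r → x + q * (s + r) ≡ (x + r * q) + q * s
  shuffle = solve-∀

  -- Both (1 + u)^b and `N` are the remainder of `Q` modulo `r`, hence equal. Comparing their
  -- base-`u` digits at position `a` makes the binomial coefficient equal to 1 + 2c, an odd number.
  maskWitness-sound : ∀ {a u U P Q q h c l} → MaskWitness a b u U P Q q h c l → a ⊑ b
  maskWitness-sound {a} {q = q} {h} {c} {l} (maskWitness refl refl refl refl l< c< N< Q≡N) =
    bit-odd (oddC b a) (proj₁ (binom-parity b a)) (trans (sym (proj₂ (binom-parity b a))) binom≡)
    where
    U = 2 ^ ((b + 1) * a)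
    U≡u^a : U ≡ u ^ a
    U≡u^a = sym (^-*-assoc 2 (b + 1) a)
    C = 1 + (c + c)
    N = l + U * (C + u * h)
    N<r : N < r
    N<r = +-cancelʳ-< s N r (subst (N + s <_) (trans (sym s+r≡P) (+-comm s r)) N<)
    pow≡N : s ^ b ≡ N
    pow≡N with pow-mod s r b
    ... | q′ , e = rem-unique q′ q pow<r N<r (trans (sym e) (trans (sym Q≡pow)
      (+-cancelʳ-≡ (q * s) _ _ (trans Q≡N (trans (cong (λ z → N + q * z) (sym s+r≡P)) (shuffle N q s r))))))
    expand = pow-expand u b binom<u a
    upper≡ : upper u b a ≡ C + u * h
    upper≡ = quot-unique _ _ (proj₁ (proj₂ expand)) (subst (l <_) U≡u^a l<)
      (trans (sym (proj₂ (proj₂ expand))) (trans pow≡N (cong (λ z → l + z * (C + u * h)) U≡u^a)))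
    binom≡ : binom b a ≡ C
    binom≡ = rem-unique (upper u b (suc a)) h (binom<u a) c< (trans (sym (upper-step u b a)) upper≡)
    bit-odd : ∀ o d → bit o + (d + d) ≡ 1 + (c + c) → o ≡ true
    bit-odd true  d e = refl
    bit-odd false d e = ⊥-elim (odd≢ d c e)
      where
      odd≢ : ∀ d c → d + d ≢ 1 + (c + c)
      odd≢ (suc d) zero    e = 1+n≢0 (trans (sym (+-suc d d)) (suc-injective e))
      odd≢ (suc d) (suc c) e = odd≢ d c (suc-injective (trans (sym (+-suc d d))
        (trans (suc-injective e) (cong suc (+-suc c c)))))

  maskWitness-complete : ∀ {a} → a ⊑ b →
    Σ ℕ λ q → Σ ℕ λ h → Σ ℕ λ c → Σ ℕ λ l →
    MaskWitness a b u (2 ^ ((b + 1) * a)) P (2 ^ (maskDegree b * b)) q h c l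
  maskWitness-complete {a} a⊑b with binom-parity b a | pow-expand u b binom<u a | pow-mod s r b
  ... | c , c≡ | l , l< , e | q , q≡ = q , h , c , l ,
    maskWitness refl refl refl refl (subst (l <_) (sym U≡u^a) l<) (subst (_< u) binom≡ (binom<u a))
      (subst (λ z → z + s < P) pow≡N pow-small)
      (begin
        2 ^ (maskDegree b * b) + q * s  ≡⟨ cong (_+ q * s) (trans Q≡pow q≡) ⟩
        (s ^ b + r * q) + q * s         ≡⟨ shuffle (s ^ b) q s r ⟨
        s ^ b + q * (s + r)             ≡⟨ cong₂ (λ x y → x + q * y) pow≡N s+r≡P ⟩
        N + q * P                       ∎)
    where
    open ≡-Reasoning
    h = upper u b (suc a)
    U = 2 ^ ((b + 1) * a)
    U≡u^a : U ≡ u ^ a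
    U≡u^a = sym (^-*-assoc 2 (b + 1) a)
    N = l + U * ((1 + (c + c)) + u * h)
    binom≡ : binom b a ≡ 1 + (c + c)
    binom≡ = trans c≡ (cong (λ o → bit o + (c + c)) a⊑b)
    pow≡N : s ^ b ≡ N
    pow≡N = trans e (trans (cong (λ z → l + u ^ a * z) (upper-step u b a))
      (cong₂ (λ x y → l + x * (y + u * h)) (sym U≡u^a) binom≡))

-- Exponential Diophantine formulas

infixl 6 _⊕_
infixl 7 _⊗_
infix 4 _≐_ _≺_ _≐2^_
infixr 3 _and_

data Tm (V : Set) : Set where
  con : ℕ → Tm V
  var : V → Tm V
  _⊕_ _⊗_ : Tm V → Tm V → Tm V

ev : {V : Set} → (V → ℕ) → Tm V → ℕ
ev σ (con k) = k
ev σ (var x) = σ x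
ev σ (s ⊕ t) = ev σ s + ev σ t
ev σ (s ⊗ t) = ev σ s * ev σ t

mapTm : {V W : Set} → (V → W) → Tm V → Tm W
mapTm ρ (con k) = con k
mapTm ρ (var x) = var (ρ x)
mapTm ρ (s ⊕ t) = mapTm ρ s ⊕ mapTm ρ t
mapTm ρ (s ⊗ t) = mapTm ρ s ⊗ mapTm ρ t

ev-map : {V W : Set} (ρ : V → W) {σ : V → ℕ} {τ : W → ℕ} → (∀ x → τ (ρ x) ≡ σ x) →
  ∀ t → ev τ (mapTm ρ t) ≡ ev σ t
ev-map ρ h (con k) = refl
ev-map ρ h (var x) = h x
ev-map ρ h (s ⊕ t) = cong₂ _+_ (ev-map ρ h s) (ev-map ρ h t)
ev-map ρ h (s ⊗ t) = cong₂ _*_ (ev-map ρ h s) (ev-map ρ h t)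

-- Variables are indexed by sums of sets rather than by numbers. As `to` is a section of `from`, a
-- conjunction over `Fin size` reaches every element.
record Finite (F : Set) : Set where
  field
    size    : ℕ
    to      : F → Fin size
    from    : Fin size → F
    from-to : ∀ x → from (to x) ≡ x

finite-Fin : ∀ k → Finite (Fin k)
finite-Fin k = record { size = k ; to = λ i → i ; from = λ i → i ; from-to = λ _ → refl }

finite-⊎ : {F G : Set} → Finite F → Finite G → Finite (F ⊎ G)
finite-⊎ f g = record
  { size    = F.size + G.size
  ; to      = join F.size G.size ∘ map⊎ F.to G.to
  ; from    = map⊎ F.from G.from ∘ splitAt F.size
  ; from-to = λ where
      (inj₁ x) → trans (cong (map⊎ F.from G.from) (splitAt-↑ˡ F.size (F.to x) G.size)) (cong inj₁ (F.from-to x))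
      (inj₂ y) → trans (cong (map⊎ F.from G.from) (splitAt-↑ʳ F.size G.size (G.to y))) (cong inj₂ (G.from-to y))
  }
  where
  module F = Finite f
  module G = Finite g

data Atom (W : Set) : Set where
  _≐_ _≺_ _≐2^_ : Tm W → Tm W → Atom W

Holds : {W : Set} → (W → ℕ) → Atom W → Set
Holds σ (s ≐ t)   = ev σ s ≡ ev σ t
Holds σ (s ≺ t)   = ev σ s < ev σ t
Holds σ (s ≐2^ t) = ev σ s ≡ 2 ^ ev σ t

data Form (W : Set) : Set₁ where
  atom  : Atom W → Form W
  _and_ : Form W → Form W → Form W
  ex    : {F : Set} → Finite F → Form (W ⊎ F) → Form W

Sat : {W : Set} → (W → ℕ) → Form W → Set
Sat σ (atom a)      = Holds σ a
Sat σ (φ and ψ)     = Sat σ φ × Sat σ ψ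
Sat σ (ex {F} _ φ)  = Σ (F → ℕ) λ ys → Sat [ σ , ys ] φ

allF : {W : Set} (n : ℕ) → (Fin n → Form W) → Form W
allF zero    φ = atom (con 0 ≐ con 0)
allF (suc n) φ = φ fzero and allF n (φ ∘ fsuc)

allF-sound : {W : Set} {σ : W → ℕ} (n : ℕ) (φ : Fin n → Form W) → Sat σ (allF n φ) → ∀ i → Sat σ (φ i)
allF-sound (suc n) φ (s , _) fzero    = s
allF-sound (suc n) φ (_ , s) (fsuc i) = allF-sound n (φ ∘ fsuc) s i

allF-complete : {W : Set} {σ : W → ℕ} (n : ℕ) (φ : Fin n → Form W) → (∀ i → Sat σ (φ i)) → Sat σ (allF n φ)
allF-complete zero    φ h = refl
allF-complete (suc n) φ h = h fzero , allF-complete n (φ ∘ fsuc) (h ∘ fsuc)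

opaque
  all : {W F : Set} → Finite F → (F → Form W) → Form W
  all f φ = allF (Finite.size f) (φ ∘ Finite.from f)

  all-sound : {W F : Set} {σ : W → ℕ} (f : Finite F) (φ : F → Form W) → Sat σ (all f φ) → ∀ x → Sat σ (φ x)
  all-sound {σ = σ} f φ s x = subst (Sat σ ∘ φ) (Finite.from-to f x)
    (allF-sound (Finite.size f) _ s (Finite.to f x))

  all-complete : {W F : Set} {σ : W → ℕ} (f : Finite F) (φ : F → Form W) → (∀ x → Sat σ (φ x)) → Sat σ (all f φ)
  all-complete f φ h = allF-complete (Finite.size f) _ (h ∘ Finite.from f)

wk : {V F : Set} → Tm V → Tm (V ⊎ F)
wk = mapTm inj₁

ev-wk : {V F : Set} {σ : V → ℕ} {ys : F → ℕ} (t : Tm V) → ev [ σ , ys ] (wk t) ≡ ev σ t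
ev-wk = ev-map inj₁ (λ _ → refl)

maskForm₀ : {W : Set} → Tm W → Tm W → Form W
maskForm₀ s t = ex (finite-Fin 8)
  ( atom (u ≐2^ b ⊕ con 1)
  and atom (U ≐2^ (b ⊕ con 1) ⊗ a)
  and atom (P ≐2^ d)
  and atom (Q ≐2^ d ⊗ b)
  and atom (l ≺ U)
  and atom (C ≺ u)
  and atom (N ⊕ (con 1 ⊕ u) ≺ P)
  and atom (Q ⊕ q ⊗ (con 1 ⊕ u) ≐ N ⊕ q ⊗ P))
  where
  a = wk s
  b = wk t
  u = var (inj₂ 0F)
  U = var (inj₂ 1F)
  P = var (inj₂ 2F)
  Q = var (inj₂ 3F)
  q = var (inj₂ 4F)
  h = var (inj₂ 5F)
  c = var (inj₂ 6F)
  l = var (inj₂ 7F)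
  d = (b ⊕ con 2) ⊗ (b ⊕ con 1) ⊕ con 1
  C = con 1 ⊕ (c ⊕ c)
  N = l ⊕ U ⊗ (C ⊕ u ⊗ h)

maskForm₀-sound : {W : Set} {σ : W → ℕ} (s t : Tm W) → Sat σ (maskForm₀ s t) → ev σ s ⊑ ev σ t
maskForm₀-sound {σ = σ} s t (ys , p₁ , p₂ , p₃ , p₄ , p₅ , p₆ , p₇ , p₈) =
  subst₂ _⊑_ (ev-wk {ys = ys} s) (ev-wk t) (Mask.maskWitness-sound (ev [ σ , ys ] (wk t))
    {ev [ σ , ys ] (wk s)} {q = ys 4F} {ys 5F} {ys 6F} {ys 7F} (maskWitness p₁ p₂ p₃ p₄ p₅ p₆ p₇ p₈))

maskForm₀-complete : {W : Set} {σ : W → ℕ} (s t : Tm W) → ev σ s ⊑ ev σ t → Sat σ (maskForm₀ s t)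
maskForm₀-complete {σ = σ} s t s⊑t with Mask.maskWitness-complete (ev σ t) s⊑t
... | q , h , c , l , w = ys , unpack (subst₂ Witness (sym (ev-wk s)) (sym (ev-wk t)) w)
  where
  b  = ev σ t
  ys = lookup (2 ^ (b + 1) ∷ 2 ^ ((b + 1) * ev σ s) ∷ 2 ^ maskDegree b ∷ 2 ^ (maskDegree b * b) ∷ q ∷ h ∷ c ∷ l ∷ [])
  Witness = λ a b → MaskWitness a b (ys 0F) (ys 1F) (ys 2F) (ys 3F) (ys 4F) (ys 5F) (ys 6F) (ys 7F)
  unpack = λ (maskWitness p₁ p₂ p₃ p₄ p₅ p₆ p₇ p₈) → p₁ , p₂ , p₃ , p₄ , p₅ , p₆ , p₇ , p₈

-- Opaque so that Sat σ (maskForm s t) determines σ, s and t.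
opaque
  maskForm : {W : Set} → Tm W → Tm W → Form W
  maskForm = maskForm₀

  maskForm-sound : {W : Set} {σ : W → ℕ} {s t : Tm W} → Sat σ (maskForm s t) → ev σ s ⊑ ev σ t
  maskForm-sound {s = s} {t} = maskForm₀-sound s t

  maskForm-complete : {W : Set} {σ : W → ℕ} {s t : Tm W} → ev σ s ⊑ ev σ t → Sat σ (maskForm s t)
  maskForm-complete {s = s} {t} = maskForm₀-complete s t

-- Flattening: the bound variables are numbered 0 … boundVars φ - 1 and placed by β.
boundVars : {W : Set} → Form W → ℕ
boundVars (atom _)  = 0
boundVars (φ and ψ) = boundVars φ + boundVars ψ
boundVars (ex f φ)  = Finite.size f + boundVars φ


mapAtom : {V W : Set} → (V → W) → Atom V → Atom W
mapAtom ρ (s ≐ t)   = mapTm ρ s ≐ mapTm ρ t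
mapAtom ρ (s ≺ t)   = mapTm ρ s ≺ mapTm ρ t
mapAtom ρ (s ≐2^ t) = mapTm ρ s ≐2^ mapTm ρ t

Holds-map : {V W : Set} (ρ : V → W) {σ : V → ℕ} {τ : W → ℕ} → (∀ x → τ (ρ x) ≡ σ x) →
  ∀ a → Holds τ (mapAtom ρ a) ≡ Holds σ a
Holds-map ρ h (s ≐ t)   = cong₂ _≡_ (ev-map ρ h s) (ev-map ρ h t)
Holds-map ρ h (s ≺ t)   = cong₂ _<_ (ev-map ρ h s) (ev-map ρ h t)
Holds-map ρ h (s ≐2^ t) = cong₂ (λ x y → x ≡ 2 ^ y) (ev-map ρ h s) (ev-map ρ h t)

flatten : {V W : Set} (φ : Form V) → (V → W) → (Fin (boundVars φ) → W) → List (Atom W)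
flatten (atom a)  ρ β = mapAtom ρ a ∷ []
flatten (φ and ψ) ρ β = flatten φ ρ (β ∘ (_↑ˡ boundVars ψ)) ++ flatten ψ ρ (β ∘ (boundVars φ ↑ʳ_))
flatten (ex f φ)  ρ β = flatten φ [ ρ , β ∘ (_↑ˡ boundVars φ) ∘ Finite.to f ] (β ∘ (Finite.size f ↑ʳ_))

flatten-sound : {V W : Set} (φ : Form V) (ρ : V → W) (β : Fin (boundVars φ) → W) {σ : V → ℕ} {τ : W → ℕ} →
  (∀ x → τ (ρ x) ≡ σ x) → All (Holds τ) (flatten φ ρ β) → Sat σ φ
flatten-sound (atom a)  ρ β h (p ∷ []) = subst (λ X → X) (Holds-map ρ h a) p
flatten-sound (φ and ψ) ρ β h ps =
  flatten-sound φ ρ _ h (All.++⁻ˡ _ ps) , flatten-sound ψ ρ _ h (All.++⁻ʳ (flatten φ ρ _) ps)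
flatten-sound (ex f φ)  ρ β {τ = τ} h ps = τ ∘ β ∘ (_↑ˡ boundVars φ) ∘ Finite.to f ,
  flatten-sound φ _ _ (λ { (inj₁ x) → h x ; (inj₂ y) → refl }) ps

-- The values `bs` precede `ρ`, `β` and `τ` in the statement because the assignment `τ` is later
-- assembled from them.
flatten-complete : {V : Set} (φ : Form V) {σ : V → ℕ} → Sat σ φ → Σ (Fin (boundVars φ) → ℕ) λ bs →
  ∀ {W : Set} (ρ : V → W) (β : Fin (boundVars φ) → W) {τ : W → ℕ} →
  (∀ x → τ (ρ x) ≡ σ x) → (∀ i → τ (β i) ≡ bs i) → All (Holds τ) (flatten φ ρ β)
flatten-complete (atom a) s = (λ ()) , λ ρ β h g → subst (λ X → X) (sym (Holds-map ρ h a)) s ∷ []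
flatten-complete (φ and ψ) (s , s′) with flatten-complete φ s | flatten-complete ψ s′
... | bs , p | bs′ , p′ = [ bs , bs′ ] ∘ splitAt (boundVars φ) , λ ρ β h g → All.++⁺
  (p ρ _ h λ i → trans (g (i ↑ˡ boundVars ψ)) (cong [ bs , bs′ ] (splitAt-↑ˡ (boundVars φ) i (boundVars ψ))))
  (p′ ρ _ h λ i → trans (g (boundVars φ ↑ʳ i)) (cong [ bs , bs′ ] (splitAt-↑ʳ (boundVars φ) (boundVars ψ) i)))
flatten-complete (ex f φ) (ys , s) with flatten-complete φ s
... | bs , p = [ ys ∘ F.from , bs ] ∘ splitAt F.size , λ ρ β h g → p _ _
  (λ { (inj₁ x) → h x
     ; (inj₂ y) → trans (g (F.to y ↑ˡ boundVars φ))
         (trans (cong [ ys ∘ F.from , bs ] (splitAt-↑ˡ F.size (F.to y) (boundVars φ))) (cong ys (F.from-to y))) })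
  λ i → trans (g (F.size ↑ʳ i)) (cong [ ys ∘ F.from , bs ] (splitAt-↑ʳ F.size (boundVars φ) i))
  where module F = Finite f

-- Loop relations and their parallel execution

infixr 3 _&_

-- The atomic relations are those that one linear equation between numbers can impose on all digits
-- at once; all other arithmetic is programmed by loops. In `loop R E` the two copies of `V` are the
-- registers before and after an iteration.
data Rel (V : Set) : Set₁ where
  zer     : V → Rel V
  suk eqv : V → V → Rel V
  _&_     : Rel V → Rel V → Rel V
  exs     : (k : ℕ) → Rel (V ⊎ Fin k) → Rel V
  loop    : Rel (V ⊎ V) → Rel V → Rel V

data Iter {S : Set} (R : S → S → Set) (E : S → Set) : S → Set where
  done : ∀ {s} → E s → Iter R E s
  step : ∀ {s s′} → R s s′ → Iter R E s′ → Iter R E s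

Sem : {V : Set} → Rel V → (V → ℕ) → Set
Sem (zer x)    s = s x ≡ 0
Sem (suk x y)  s = s x ≡ suc (s y)
Sem (eqv x y)  s = s x ≡ s y
Sem (Q & R)    s = Sem Q s × Sem R s
Sem (exs k R)  s = Σ (Fin k → ℕ) λ ys → Sem R [ s , ys ]
Sem (loop R E) s = Iter (λ s s′ → Sem R [ s , s′ ]) (Sem E) s

Sem-cong : {V : Set} (R : Rel V) {s s′ : V → ℕ} → (∀ x → s x ≡ s′ x) → Sem R s → Sem R s′
Sem-cong (zer x)    h p = trans (sym (h x)) p
Sem-cong (suk x y)  h p = trans (sym (h x)) (trans p (cong suc (h y)))
Sem-cong (eqv x y)  h p = trans (sym (h x)) (trans p (h y))
Sem-cong (Q & R)    h (p , q) = Sem-cong Q h p , Sem-cong R h q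
Sem-cong (exs k R)  h (ys , p) = ys , Sem-cong R (λ { (inj₁ x) → h x ; (inj₂ y) → refl }) p
Sem-cong (loop R E) h (done e) = done (Sem-cong E h e)
Sem-cong (loop R E) h (step r i) = step (Sem-cong R (λ { (inj₁ x) → h x ; (inj₂ y) → refl }) r) i

record Values {V W : Set} (σ : W → ℕ) (wT KT MT : Tm W) (XT : V → Tm W)
              (w K M : ℕ) (X : V → ℕ) : Set where
  constructor values
  field
    w≡   : ev σ wT ≡ w
    K≡   : ev σ KT ≡ K
    M≡   : ev σ MT ≡ M
    X≡   : ∀ x → ev σ (XT x) ≡ X x
    base : 2 ^ w ≡ Digits.B K

m≤1-cases : ∀ {m} → m ≤ 1 → m ≡ 0 ⊎ m ≡ 1
m≤1-cases z≤n       = inj₁ refl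
m≤1-cases (s≤s z≤n) = inj₂ refl

LoopVar : Set → Set
LoopVar V = Fin 4 ⊎ (V ⊎ (V ⊎ V))

finite-LoopVar : {V : Set} → Finite V → Finite (LoopVar V)
finite-LoopVar f = finite-⊎ (finite-Fin 4) (finite-⊎ f (finite-⊎ f f))

module LoopVars {V A : Set} (var : LoopVar V → A) where
  T₀ D N O : A
  T₀ = var (inj₁ 0F)
  D  = var (inj₁ 1F)
  N  = var (inj₁ 2F)
  O  = var (inj₁ 3F)
  SN SO S′ : V → A
  SN x = var (inj₂ (inj₁ x))
  SO x = var (inj₂ (inj₂ (inj₁ x)))
  S′ x = var (inj₂ (inj₂ (inj₂ x)))

module Loop {V : Set} (K w : ℕ) (base : 2 ^ w ≡ Digits.B K) where
  open Digits K

  -- `L≡` balances tokens: a position is occupied (`N + O`) by an initial token or by one arriving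
  -- from `T` positions below. `M⊑` forbids an arrival at an initially occupied position, since 1 +
  -- 1 has no binary digit 1 in the lowest place. `S≡` is the same balance for registers, and the
  -- conditions with `K` bound the registers and clear them off the masks.
  record LoopNumbers (M : ℕ) (X : V → ℕ) (ys : LoopVar V → ℕ) : Set where
    open LoopVars ys
    field
      D≡   : D ≡ 2 ^ (w * (1 + T₀))
      L≡   : N + O ≡ M + D * N
      M⊑   : M ⊑ M + D * N
      N⊑   : N ⊑ N + O
      S≡   : ∀ x → X x + D * S′ x ≡ SN x + SO x
      SN⊑  : ∀ x → SN x ⊑ K * N
      SO⊑  : ∀ x → SO x ⊑ K * O
      S′⊑  : ∀ x → S′ x ⊑ K * N

  module Sound {M X} (ys : LoopVar V → ℕ) (ln : LoopNumbers M X ys)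
               (maskM : Mask M) (suppX : ∀ x t → dig (X x) t ≤ K * dig M t) where
    open LoopVars ys
    open LoopNumbers ln

    T : ℕ
    T = suc T₀

    D≡B^T : D ≡ B ^ T
    D≡B^T = trans D≡ (trans (sym (^-*-assoc 2 w T)) (cong (_^ T) base))

    dig-D* : ∀ C t → dig (D * C) t ≡ shift T (dig C) t
    dig-D* C t = trans (cong (λ d → dig (d * C) t) D≡B^T) (dig-shift T C t)

    L : ℕ → ℕ
    L = dig (N + O)

    N≤L : ∀ t → dig N t ≤ L t
    N≤L t = ⊑⇒≤ (⊑⇒dig-⊑ w base N (N + O) N⊑ t)

    L≡n+o : ∀ t → L t ≡ dig N t + dig O t
    L≡n+o = dig-+-≤ N O N≤L

    M⊑L : ∀ t → dig M t ⊑ L t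
    M⊑L t = subst (λ z → dig M t ⊑ dig z t) (sym L≡) (⊑⇒dig-⊑ w base M (M + D * N) M⊑ t)

    L≡m+n : ∀ t → L t ≡ dig M t + shift T (dig N) t
    L≡m+n t = trans (cong (λ z → dig z t) L≡)
      (trans (dig-+-≤ M (D * N) (λ t → ⊑⇒≤ (⊑⇒dig-⊑ w base M (M + D * N) M⊑ t)) t)
             (cong (dig M t +_) (dig-D* N t)))

    -- Strong induction on the position: an arrival at `t` comes from a smaller position, since `T`
    -- is positive, so there is at most one. Together with an initial token it would give the digit
    -- 2, but 1 ⊑ 2 fails.
    L≤1 : ∀ t → L t ≤ 1
    L≤1 = <-rec _ λ t ih → bound t (shift≤1 t ih)
      where
      shift≤1 : ∀ t → (∀ {u} → u < t → L u ≤ 1) → shift T (dig N) t ≤ 1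
      shift≤1 t ih with shift-view T t
      ... | inj₁ (_ , z) = subst (_≤ 1) (sym (z (dig N))) z≤n
      ... | inj₂ (u , e , z) = subst (_≤ 1) (sym (z (dig N)))
        (≤-trans (N≤L u) (ih (subst (u <_) (sym e) (s≤s (m≤n+m u T₀)))))
      bound : ∀ t → shift T (dig N) t ≤ 1 → L t ≤ 1
      bound t s≤1 with m≤1-cases (maskM t) | m≤1-cases s≤1
      ... | inj₁ m | inj₁ s = subst (_≤ 1) (sym (trans (L≡m+n t) (cong₂ _+_ m s))) z≤n
      ... | inj₁ m | inj₂ s = ≤-reflexive (trans (L≡m+n t) (cong₂ _+_ m s))
      ... | inj₂ m | inj₁ s = ≤-reflexive (trans (L≡m+n t) (cong₂ _+_ m s))
      ... | inj₂ m | inj₂ s with trans (sym (M⊑L t)) (cong₂ oddC (trans (L≡m+n t) (cong₂ _+_ m s)) m)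
      ... | ()

    maskN : Mask N
    maskN t = ≤-trans (N≤L t) (L≤1 t)

    maskO : Mask O
    maskO t = ≤-trans (subst (dig O t ≤_) (sym (L≡n+o t)) (m≤n+m (dig O t) (dig N t))) (L≤1 t)

    suppSN : ∀ x t → dig (SN x) t ≤ K * dig N t
    suppSN x = ⊑K⇒dig-≤ w base N (SN x) maskN (SN⊑ x)

    suppSO : ∀ x t → dig (SO x) t ≤ K * dig O t
    suppSO x = ⊑K⇒dig-≤ w base O (SO x) maskO (SO⊑ x)

    suppS′ : ∀ x t → dig (S′ x) t ≤ K * dig N t
    suppS′ x = ⊑K⇒dig-≤ w base N (S′ x) maskN (S′⊑ x)

    sum<B : ∀ {a b c d} → a ≤ K * c → b ≤ K * d → c + d ≤ 1 → a + b < B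
    sum<B {c = c} {d} p q r = ≤-<-trans (+-mono-≤ p q) (≤-<-trans
      (subst (_≤ K) (*-distribˡ-+ K c d) (subst (K * (c + d) ≤_) (*-identityʳ K) (*-monoʳ-≤ K r)))
      (m<n⇒m<1+n (s≤s (m≤m+n K K))))

    shift-≤ : ∀ x t → shift T (dig (S′ x)) t ≤ K * shift T (dig N) t
    shift-≤ x t with shift-view T t
    ... | inj₁ (_ , z)     rewrite z (dig (S′ x)) = z≤n
    ... | inj₂ (u , _ , z) rewrite z (dig (S′ x)) | z (dig N) = suppS′ x u

    -- The balance of whole numbers becomes a balance at each position because neither side has
    -- carries.
    registers : ∀ x t → dig (X x) t + shift T (dig (S′ x)) t ≡ dig (SN x) t + dig (SO x) t
    registers x t = begin
      dig (X x) t + shift T (dig (S′ x)) t  ≡⟨ cong (dig (X x) t +_) (dig-D* (S′ x) t) ⟨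
      dig (X x) t + dig (D * S′ x) t        ≡⟨ dig-+ (X x) (D * S′ x) lhs t ⟨
      dig (X x + D * S′ x) t                ≡⟨ cong (λ z → dig z t) (S≡ x) ⟩
      dig (SN x + SO x) t                   ≡⟨ dig-+ (SN x) (SO x) rhs t ⟩
      dig (SN x) t + dig (SO x) t           ∎
      where
      open ≡-Reasoning
      lhs : ∀ t → dig (X x) t + dig (D * S′ x) t < B
      lhs t = sum<B {c = dig M t} (suppX x t)
        (subst (_≤ K * shift T (dig N) t) (sym (dig-D* (S′ x) t)) (shift-≤ x t))
        (subst (_≤ 1) (L≡m+n t) (L≤1 t))
      rhs : ∀ t → dig (SN x) t + dig (SO x) t < B
      rhs t = sum<B {c = dig N t} (suppSN x t) (suppSO x t) (subst (_≤ 1) (L≡n+o t) (L≤1 t))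

    off : ∀ C A t → dig C t ≤ K * dig A t → dig A t ≡ 0 → dig C t ≡ 0
    off C A t p e = n≤0⇒n≡0 (subst (dig C t ≤_) (trans (cong (K *_) e) (*-zeroʳ K)) p)

    module _ {R : (V → ℕ) → (V → ℕ) → Set} {E : (V → ℕ) → Set}
             (R-cong : ∀ {s₁ s₂ s′} → (∀ x → s₁ x ≡ s₂ x) → R s₁ s′ → R s₂ s′)
             (E-cong : ∀ {s₁ s₂} → (∀ x → s₁ x ≡ s₂ x) → E s₁ → E s₂)
             (body : ∀ t → dig N t ≡ 1 → R (λ x → dig (SN x) t) (λ x → dig (S′ x) t))
             (exit : ∀ t → dig O t ≡ 1 → E (λ x → dig (SO x) t)) where

      -- Every iteration moves the token up by `T ≥ 1`, and `N + O` has only zero digits from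
      -- position `N + O` on. So the token must leave; the fuel bounds the remaining distance.
      iter : ∀ fuel t → N + O ≤ t + fuel → L t ≡ 1 →
             ∀ s → (∀ x → s x ≡ dig (SN x) t + dig (SO x) t) → Iter R E s
      iter zero t b L≡1 s h with trans (sym L≡1) (dig-≥ (N + O) t (subst (N + O ≤_) (+-identityʳ t) b))
      ... | ()
      iter (suc fuel) t b L≡1 s h with m≤1-cases (maskN t)
      ... | inj₁ n≡0 = done (E-cong
              (λ x → sym (trans (h x) (cong (_+ dig (SO x) t) (off (SN x) N t (suppSN x t) n≡0))))
              (exit t (trans (sym (cong (_+ dig O t) n≡0)) (trans (sym (L≡n+o t)) L≡1))))
      ... | inj₂ n≡1 = step (R-cong
              (λ x → sym (trans (h x) (trans (cong (dig (SN x) t +_) (off (SO x) O t (suppSO x t) o≡0)) (+-identityʳ _))))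
              (body t n≡1))
              (iter fuel (T + t) bound L′≡1 _ λ x →
                trans (sym (trans (cong (_+ shift T (dig (S′ x)) (T + t)) (off (X x) M (T + t) (suppX x (T + t)) m≡0))
                                  (shift-+ T (dig (S′ x)) t)))
                      (registers x (T + t)))
        where
        o≡0 : dig O t ≡ 0
        o≡0 = suc-injective (trans (sym (cong (_+ dig O t) n≡1)) (trans (sym (L≡n+o t)) L≡1))
        L′ : L (T + t) ≡ dig M (T + t) + 1
        L′ = trans (L≡m+n (T + t)) (cong (dig M (T + t) +_) (trans (shift-+ T (dig N) t) n≡1))
        -- A token has just arrived here, so none starts here: the arriving registers are not mixed
        -- with initial ones.
        m≡0 : dig M (T + t) ≡ 0
        m≡0 = n≤0⇒n≡0 (s≤s⁻¹ (subst (_≤ 1) (trans L′ (+-comm _ 1)) (L≤1 (T + t))))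
        L′≡1 : L (T + t) ≡ 1
        L′≡1 = trans L′ (cong (_+ 1) m≡0)
        bound : N + O ≤ (T + t) + fuel
        bound = ≤-trans b (subst (_≤ (T + t) + fuel) (sym (+-suc t fuel))
                  (s≤s (+-monoˡ-≤ fuel (m≤n+m t T₀))))

      run : ∀ t → dig M t ≡ 1 → Iter R E (λ x → dig (X x) t)
      run t m≡1 = iter (N + O) t (m≤n+m (N + O) t) L≡1 _ λ x →
        trans (sym (trans (cong (dig (X x) t +_) (s′≡0 x)) (+-identityʳ _))) (registers x t)
        where
        n≡0 : shift T (dig N) t ≡ 0
        n≡0 = n≤0⇒n≡0 (s≤s⁻¹ (subst (_≤ 1) (trans (L≡m+n t) (cong (_+ shift T (dig N) t) m≡1)) (L≤1 t)))
        L≡1 : L t ≡ 1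
        L≡1 = trans (L≡m+n t) (cong₂ _+_ m≡1 n≡0)
        s′≡0 : ∀ x → shift T (dig (S′ x)) t ≡ 0
        s′≡0 x = n≤0⇒n≡0 (subst (shift T (dig (S′ x)) t ≤_) (trans (cong (K *_) n≡0) (*-zeroʳ K)) (shift-≤ x t))

opaque
  loopForm : {V W : Set} → Finite V → (w K M : Tm W) → (V → Tm W) →
    Form (W ⊎ LoopVar V) → Form (W ⊎ LoopVar V) → Form W
  loopForm {V} {W} f w K M X body exit = ex (finite-LoopVar f)
    ( (atom (D ≐2^ wk w ⊗ (con 1 ⊕ T₀))
    and atom (N ⊕ O ≐ wk M ⊕ D ⊗ N)
    and maskForm (wk M) (wk M ⊕ D ⊗ N)
    and maskForm N (N ⊕ O)
    and all f (λ x → atom (wk (X x) ⊕ D ⊗ S′ x ≐ SN x ⊕ SO x)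
                 and maskForm (SN x) (wk K ⊗ N)
                 and maskForm (SO x) (wk K ⊗ O)
                 and maskForm (S′ x) (wk K ⊗ N)))
    and body and exit)
    where open LoopVars {V} {Tm (W ⊎ LoopVar V)} (λ y → var (inj₂ y))

  loopForm-sound : {V W : Set} (f : Finite V) {wT KT MT : Tm W} {XT : V → Tm W} {body exit : Form (W ⊎ LoopVar V)}
    {σ : W → ℕ} {w K M : ℕ} {X : V → ℕ} (v : Values σ wT KT MT XT w K M X) →
    Sat σ (loopForm f wT KT MT XT body exit) → Σ (LoopVar V → ℕ) λ ys →
    Loop.LoopNumbers K w (Values.base v) M X ys × Sat [ σ , ys ] body × Sat [ σ , ys ] exit
  loopForm-sound {V} f {wT} {KT} {MT} {XT} {σ = σ} {w} {K} {M} {X} (values w≡ K≡ M≡ X≡ b)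
    (ys , (p₁ , p₂ , p₃ , p₄ , p₅) , p₆ , p₇) = ys , numbers , p₆ , p₇
    where
    open LoopVars ys
    wk-K : ev [ σ , ys ] (wk KT) ≡ K
    wk-K = trans (ev-wk KT) K≡
    wk-M : ev [ σ , ys ] (wk MT) ≡ M
    wk-M = trans (ev-wk MT) M≡
    numbers : Loop.LoopNumbers K w b M X ys
    numbers = let each = all-sound f _ p₅ in record
      { D≡  = trans p₁ (cong (λ z → 2 ^ (z * (1 + T₀))) (trans (ev-wk wT) w≡))
      ; L≡  = trans p₂ (cong (_+ D * N) wk-M)
      ; M⊑  = subst₂ (λ a c → a ⊑ c + D * N) wk-M wk-M (maskForm-sound p₃)
      ; N⊑  = maskForm-sound p₄
      ; S≡  = λ x → trans (cong (_+ D * S′ x) (sym (trans (ev-wk (XT x)) (X≡ x)))) (proj₁ (each x))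
      ; SN⊑ = λ x → subst (λ z → SN x ⊑ z * N) wk-K (maskForm-sound (proj₁ (proj₂ (each x))))
      ; SO⊑ = λ x → subst (λ z → SO x ⊑ z * O) wk-K (maskForm-sound (proj₁ (proj₂ (proj₂ (each x)))))
      ; S′⊑ = λ x → subst (λ z → S′ x ⊑ z * N) wk-K (maskForm-sound (proj₂ (proj₂ (proj₂ (each x)))))
      }

  loopForm-complete : {V W : Set} (f : Finite V) {wT KT MT : Tm W} {XT : V → Tm W} {body exit : Form (W ⊎ LoopVar V)}
    {σ : W → ℕ} {w K M : ℕ} {X : V → ℕ} (v : Values σ wT KT MT XT w K M X) (ys : LoopVar V → ℕ) →
    Loop.LoopNumbers K w (Values.base v) M X ys → Sat [ σ , ys ] body → Sat [ σ , ys ] exit →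
    Sat σ (loopForm f wT KT MT XT body exit)
  loopForm-complete {V} f {wT} {KT} {MT} {XT} {σ = σ} {w} {K} {M} {X} (values w≡ K≡ M≡ X≡ b) ys numbers p₆ p₇ =
    ys ,
    ( trans D≡ (cong (λ z → 2 ^ (z * (1 + T₀))) (sym (trans (ev-wk wT) w≡)))
    , trans L≡ (cong (_+ D * N) (sym wk-M))
    , maskForm-complete (subst₂ (λ a c → a ⊑ c + D * N) (sym wk-M) (sym wk-M) M⊑)
    , maskForm-complete N⊑
    , all-complete f _ λ x →
        trans (cong (_+ D * S′ x) (trans (ev-wk (XT x)) (X≡ x))) (S≡ x)
      , maskForm-complete (subst (λ z → SN x ⊑ z * N) (sym wk-K) (SN⊑ x))
      , maskForm-complete (subst (λ z → SO x ⊑ z * O) (sym wk-K) (SO⊑ x))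
      , maskForm-complete (subst (λ z → S′ x ⊑ z * N) (sym wk-K) (S′⊑ x)))
    , p₆ , p₇
    where
    open LoopVars ys
    open Loop.LoopNumbers numbers
    wk-K : ev [ σ , ys ] (wk KT) ≡ K
    wk-K = trans (ev-wk KT) K≡
    wk-M : ev [ σ , ys ] (wk MT) ≡ M
    wk-M = trans (ev-wk MT) M≡

-- A token sits at every digit position t with M(t) = 1 (base 2K + 2 = 2^w), and its x-th register
-- is the digit X(t). A loop moves its tokens from t to t + T; N and O mask the tokens that
-- go on and those that leave, SN and SO are their registers, S′ the registers after an iteration.
parallel : {V W : Set} → Finite V → Rel V → (w K M : Tm W) → (V → Tm W) → Form W
parallel f (zer x)    w K M X = atom (X x ≐ con 0)
parallel f (suk x y)  w K M X = atom (X x ≐ X y ⊕ M)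
parallel f (eqv x y)  w K M X = atom (X x ≐ X y)
parallel f (Q & R)    w K M X = parallel f Q w K M X and parallel f R w K M X
parallel f (exs k R)  w K M X = ex (finite-Fin k)
  ( all (finite-Fin k) (λ i → maskForm (var (inj₂ i)) (wk K ⊗ wk M))
  and parallel (finite-⊎ f (finite-Fin k)) R (wk w) (wk K) (wk M) [ wk ∘ X , (λ i → var (inj₂ i)) ])
parallel {V} {W} f (loop R E) w K M X = loopForm f w K M X
  (parallel (finite-⊎ f f) R (wk w) (wk K) N [ SN , S′ ])
  (parallel f E (wk w) (wk K) O SO)
  where open LoopVars {V} {Tm (W ⊎ LoopVar V)} (λ y → var (inj₂ y))

-- The final application has a single token, but arbitrary masks are needed for the induction: the
-- body of a loop is treated with the mask `N` of all iterations of all tokens, its exit condition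
-- with the mask `O`.
parallel-sound : {V W : Set} (f : Finite V) (R : Rel V) {wT KT MT : Tm W} {XT : V → Tm W} {σ : W → ℕ} →
  ∀ {w K M X} → Values σ wT KT MT XT w K M X → let open Digits K in
  Mask M → (∀ x t → dig (X x) t ≤ K * dig M t) →
  Sat σ (parallel f R wT KT MT XT) → ∀ t → dig M t ≡ 1 → Sem R (λ x → dig (X x) t)
parallel-sound f (zer x) {K = K} (values w≡ K≡ M≡ X≡ b) mask supp s t on =
  trans (cong (λ z → dig z t) (trans (sym (X≡ x)) s)) (dig-0 t)
  where open Digits K
parallel-sound f (suk x y) {K = K} {M} {X} (values w≡ K≡ M≡ X≡ b) mask supp s t on = begin
  dig (X x) t              ≡⟨ cong (λ z → dig z t) (trans (sym (X≡ x)) (trans s (cong₂ _+_ (X≡ y) M≡))) ⟩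
  dig (X y + M) t          ≡⟨ dig-+ (X y) M (λ u → nocarry (mask u) (supp y u)) t ⟩
  dig (X y) t + dig M t    ≡⟨ cong (dig (X y) t +_) on ⟩
  dig (X y) t + 1          ≡⟨ +-comm _ 1 ⟩
  suc (dig (X y) t)        ∎
  where
  open ≡-Reasoning
  open Digits K
  nocarry : ∀ {m x} → m ≤ 1 → x ≤ K * m → x + m < B
  nocarry {m} {x} p q = s≤s (≤-trans (+-mono-≤ (≤-trans q (≤-trans (*-monoʳ-≤ K p) (≤-reflexive (*-identityʳ K)))) p)
                    (≤-trans (≤-reflexive (+-comm K 1)) (s≤s (m≤m+n K K))))
parallel-sound f (eqv x y) {K = K} (values w≡ K≡ M≡ X≡ b) mask supp s t on =
  cong (λ z → Digits.dig K z t) (trans (sym (X≡ x)) (trans s (X≡ y)))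
parallel-sound f (Q & R) v mask supp (p , q) t on =
  parallel-sound f Q v mask supp p t on , parallel-sound f R v mask supp q t on
parallel-sound f (exs k R) {wT} {KT} {MT} {XT} {σ = σ} {w} {K} {M} {X}
  (values w≡ K≡ M≡ X≡ b) mask supp (ys , p , q) t on =
  (λ i → dig (ys i) t) ,
  Sem-cong R (λ { (inj₁ x) → refl ; (inj₂ i) → refl })
    (parallel-sound (finite-⊎ f (finite-Fin k)) R {X = [ X , ys ]}
      (values (trans (ev-wk wT) w≡) (trans (ev-wk KT) K≡) (trans (ev-wk MT) M≡)
              (λ { (inj₁ x) → trans (ev-wk (XT x)) (X≡ x) ; (inj₂ i) → refl }) b)
      mask
      (λ { (inj₁ x) → supp x
         ; (inj₂ i) → ⊑K⇒dig-≤ w b M (ys i) mask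
             (subst (ys i ⊑_) (cong₂ _*_ (trans (ev-wk KT) K≡) (trans (ev-wk MT) M≡))
               (maskForm-sound (all-sound (finite-Fin k) _ p i))) })
      q t on)
  where open Digits K
parallel-sound {V} f (loop R E) {wT} {KT} {σ = σ} {w} {K} {M} {X} v@(values w≡ K≡ M≡ X≡ b) mask supp sat t on
  with loopForm-sound f v sat
... | ys , numbers , p , q =
  S.run (λ h → Sem-cong R (λ { (inj₁ x) → h x ; (inj₂ x) → refl })) (Sem-cong E)
    (λ t n≡1 → Sem-cong R (λ { (inj₁ x) → refl ; (inj₂ x) → refl })
      (parallel-sound (finite-⊎ f f) R {X = [ SN , S′ ]}
        (values wk-w wk-K refl (λ { (inj₁ x) → refl ; (inj₂ x) → refl }) b) S.maskN
        (λ { (inj₁ x) → S.suppSN x ; (inj₂ x) → S.suppS′ x }) p t n≡1))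
    (λ t o≡1 → parallel-sound f E (values wk-w wk-K refl (λ _ → refl) b) S.maskO S.suppSO q t o≡1)
    t on
  where
  open LoopVars ys
  module S = Loop.Sound K w b ys numbers mask supp
  wk-w : ev [ σ , ys ] (wk wT) ≡ w
  wk-w = trans (ev-wk wT) w≡
  wk-K : ev [ σ , ys ] (wk KT) ≡ K
  wk-K = trans (ev-wk KT) K≡

-- Traces of loops and their layout on digit positions

data Trace {V : Set} (R : (V → ℕ) → (V → ℕ) → Set) (E : (V → ℕ) → Set) : ℕ → (V → ℕ) → Set where
  -- An unmarked position has no token, and its registers must then be 0.
  none : ∀ {s} → (∀ x → s x ≡ 0) → Trace R E 0 s
  done : ∀ {s} → E s → Trace R E 1 s
  step : ∀ {s s′} → R s s′ → Trace R E 1 s′ → Trace R E 1 s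

module _ {V : Set} {R : (V → ℕ) → (V → ℕ) → Set} {E : (V → ℕ) → Set} where

  fromIter : ∀ {s} → Iter R E s → Trace R E 1 s
  fromIter (done e)   = done e
  fromIter (step r i) = step r (fromIter i)

  len : ∀ {m s} → Trace R E m s → ℕ
  len (none _)   = 0
  len (done _)   = 1
  len (step _ τ) = suc (len τ)

  goes leaves : ∀ {m s} → Trace R E m s → ℕ → ℕ
  goes (step _ τ) zero    = 1
  goes (step _ τ) (suc j) = goes τ j
  goes (none _)   j       = 0
  goes (done _)   j       = 0
  leaves (step _ τ) zero    = 0
  leaves (step _ τ) (suc j) = leaves τ j
  leaves (none _)   j       = 0
  leaves (done _)   zero    = 1
  leaves (done _)   (suc j) = 0

  before after final : ∀ {m s} → Trace R E m s → V → ℕ → ℕ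
  before (step {s} _ τ) x zero    = s x
  before (step _ τ)     x (suc j) = before τ x j
  before (none _)       x j       = 0
  before (done _)       x j       = 0
  after (step {s′ = s′} _ τ) x zero    = s′ x
  after (step _ τ)           x (suc j) = after τ x j
  after (none _)             x j       = 0
  after (done _)             x j       = 0
  final (step _ τ)   x zero    = 0
  final (step _ τ)   x (suc j) = final τ x j
  final (none _)     x j       = 0
  final (done {s} _) x zero    = s x
  final (done _)     x (suc j) = 0

  goes-≤1 : ∀ {m s} (τ : Trace R E m s) j → goes τ j ≤ 1
  goes-≤1 (step _ τ) zero    = ≤-refl
  goes-≤1 (step _ τ) (suc j) = goes-≤1 τ j
  goes-≤1 (none _)   j       = z≤n
  goes-≤1 (done _)   j       = z≤n

  leaves-≤1 : ∀ {m s} (τ : Trace R E m s) j → leaves τ j ≤ 1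
  leaves-≤1 (step _ τ) zero    = z≤n
  leaves-≤1 (step _ τ) (suc j) = leaves-≤1 τ j
  leaves-≤1 (none _)   j       = z≤n
  leaves-≤1 (done _)   zero    = ≤-refl
  leaves-≤1 (done _)   (suc j) = z≤n

  -- This and the next three lemmas are the balance equations `L≡` and `S≡` along a single trace, at
  -- its start and at later moments.
  tokens-zero : ∀ {m s} (τ : Trace R E m s) → goes τ 0 + leaves τ 0 ≡ m
  tokens-zero (none _)   = refl
  tokens-zero (done _)   = refl
  tokens-zero (step _ τ) = refl

  tokens-suc : ∀ {m s} (τ : Trace R E m s) j → goes τ (suc j) + leaves τ (suc j) ≡ goes τ j
  tokens-suc (none _)   j       = refl
  tokens-suc (done _)   j       = refl
  tokens-suc (step _ τ) zero    = tokens-zero τ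
  tokens-suc (step _ τ) (suc j) = tokens-suc τ j

  state-zero : ∀ {m s} (τ : Trace R E m s) x → before τ x 0 + final τ x 0 ≡ s x
  state-zero (none h)   x = sym (h x)
  state-zero (done _)   x = refl
  state-zero (step _ τ) x = +-identityʳ _

  state-suc : ∀ {m s} (τ : Trace R E m s) x j → before τ x (suc j) + final τ x (suc j) ≡ after τ x j
  state-suc (none _)   x j       = refl
  state-suc (done _)   x j       = refl
  state-suc (step _ τ) x zero    = state-zero τ x
  state-suc (step _ τ) x (suc j) = state-suc τ x j

  before-off : ∀ {m s} (τ : Trace R E m s) x j → goes τ j ≡ 0 → before τ x j ≡ 0
  before-off (none _)   x j       e = refl
  before-off (done _)   x j       e = refl
  before-off (step _ τ) x (suc j) e = before-off τ x j e

  after-off : ∀ {m s} (τ : Trace R E m s) x j → goes τ j ≡ 0 → after τ x j ≡ 0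
  after-off (none _)   x j       e = refl
  after-off (done _)   x j       e = refl
  after-off (step _ τ) x (suc j) e = after-off τ x j e

  final-off : ∀ {m s} (τ : Trace R E m s) x j → leaves τ j ≡ 0 → final τ x j ≡ 0
  final-off (none _)   x j       e = refl
  final-off (done _)   x (suc j) e = refl
  final-off (step _ τ) x zero    e = refl
  final-off (step _ τ) x (suc j) e = final-off τ x j e

  goes-on : ∀ {m s} (τ : Trace R E m s) j → goes τ j ≡ 1 → R (λ x → before τ x j) (λ x → after τ x j)
  goes-on (step r τ) zero    e = r
  goes-on (step r τ) (suc j) e = goes-on τ j e

  leaves-on : ∀ {m s} (τ : Trace R E m s) j → leaves τ j ≡ 1 → E (λ x → final τ x j)
  leaves-on (done p)   zero    e = p
  leaves-on (step r τ) (suc j) e = leaves-on τ j e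

  len-≤ : ∀ {m s} (τ : Trace R E m s) j → len τ ≤ j → goes τ j ≡ 0 × leaves τ j ≡ 0
  len-≤ (none _)   j       l       = refl , refl
  len-≤ (done _)   (suc j) l       = refl , refl
  len-≤ (step _ τ) (suc j) (s≤s l) = len-≤ τ j l

maxBelow : (f : ℕ → ℕ) (n : ℕ) → Σ ℕ λ b → ∀ t → t < n → f t ≤ b
maxBelow f zero    = 0 , λ _ ()
maxBelow f (suc n) with maxBelow f n
... | b , p = b ⊔ f n , λ t t<1+n → case (m≤n⇒m<n∨m≡n (s≤s⁻¹ t<1+n))
  where
  case : ∀ {t} → t < n ⊎ t ≡ n → f t ≤ b ⊔ f n
  case (inj₁ l)    = ≤-trans (p _ l) (m≤m⊔n b (f n))
  case (inj₂ refl) = m≤n⊔m b (f n)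

maxFin : (n : ℕ) (g : Fin n → ℕ) → Σ ℕ λ b → ∀ i → g i ≤ b
maxFin zero    g = 0 , λ ()
maxFin (suc n) g with maxFin n (g ∘ fsuc)
... | b , p = g fzero ⊔ b , λ { fzero → m≤m⊔n (g fzero) b ; (fsuc i) → ≤-trans (p i) (m≤n⊔m (g fzero) b) }

bounded : {F : Set} → Finite F → (f : F → ℕ → ℕ) (τ : ℕ) → (∀ x t → τ ≤ t → f x t ≡ 0) →
  Σ ℕ λ κ → ∀ x t → f x t ≤ κ
bounded fin f τ z with maxFin size (λ i → proj₁ (maxBelow (f (from i)) τ))
  where open Finite fin
... | κ , p = κ , bound
  where
  open Finite fin
  bound : ∀ x t → f x t ≤ κ
  bound x t with t <? τ
  ... | yes t<τ = subst (λ y → f y t ≤ κ) (from-to x)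
                    (≤-trans (proj₂ (maxBelow (f (from (to x))) τ) t t<τ) (p (to x)))
  ... | no t≮τ  = subst (_≤ κ) (sym (z x t (≮⇒≥ t≮τ))) z≤n

-- Position t + T·j (t < T) carries the j-th moment of the trace of the token starting at t.
module Layout (T₀ : ℕ) where
  T : ℕ
  T = suc T₀

  lay : (ℕ → ℕ → ℕ) → ℕ → ℕ
  lay g p = g (p % T) (p / T)

  lay-low : ∀ g {p} → p < T → lay g p ≡ g p 0
  lay-low g p<T = cong₂ g (m<n⇒m%n≡m p<T) (m<n⇒m/n≡0 p<T)

  lay-high : ∀ g p → lay g (T + p) ≡ g (p % T) (suc (p / T))
  lay-high g p = cong₂ g (trans (cong (_% T) (+-comm T p)) ([m+n]%n≡m%n p T))
    (trans (+-distrib-/-∣ˡ p (∣-refl {T})) (cong (_+ p / T) (n/n≡1 T)))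

record Sparse {V : Set} (m : ℕ → ℕ) (x : V → ℕ → ℕ) (τ : ℕ) : Set where
  field
    m≤1    : ∀ t → m t ≤ 1
    finite : ∀ t → τ ≤ t → m t ≡ 0
    off    : ∀ v t → m t ≡ 0 → x v t ≡ 0

record Represents {V : Set} (K M : ℕ) (X : V → ℕ) (m : ℕ → ℕ) (x : V → ℕ → ℕ) : Set where
  constructor represents
  open Digits K
  field
    M-dig : ∀ t → dig M t ≡ m t
    X-dig : ∀ v t → dig (X v) t ≡ x v t

-- The stride exceeds `T₀`, which bounds the marked positions. Hence the residue modulo `T`
-- identifies a token and the quotient its moment, and no two trajectories meet.
module LoopLayout {V : Set} {R : (V → ℕ) → (V → ℕ) → Set} {E : (V → ℕ) → Set}
  (fin : Finite V) (m : ℕ → ℕ) (x : V → ℕ → ℕ) (T₀ : ℕ) (sp : Sparse m x T₀)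
  (trace : ∀ t → Trace R E (m t) (λ v → x v t)) where

  open Sparse sp
  open Layout T₀

  n o : ℕ → ℕ
  n = lay λ t → goes (trace t)
  o = lay λ t → leaves (trace t)

  sN sO s′ : V → ℕ → ℕ
  sN v = lay λ t → before (trace t) v
  sO v = lay λ t → final (trace t) v
  s′ v = lay λ t → after (trace t) v

  n≤1 : ∀ p → n p ≤ 1
  n≤1 p = goes-≤1 (trace (p % T)) (p / T)

  o≤1 : ∀ p → o p ≤ 1
  o≤1 p = leaves-≤1 (trace (p % T)) (p / T)

  m-high : ∀ p → m (T + p) ≡ 0
  m-high p = finite (T + p) (≤-trans (n≤1+n T₀) (m≤m+n T p))

  tokens : ∀ p → m p + shift T n p ≡ n p + o p
  tokens p with shift-view T p
  ... | inj₁ (p<T , z) = trans (cong (m p +_) (z n)) (trans (+-identityʳ _) (sym (trans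
        (cong₂ _+_ (lay-low (λ t → goes (trace t)) p<T) (lay-low (λ t → leaves (trace t)) p<T))
        (tokens-zero (trace p)))))
  ... | inj₂ (q , refl , z) = trans (cong₂ _+_ (m-high q) (z n)) (sym (trans
        (cong₂ _+_ (lay-high (λ t → goes (trace t)) q) (lay-high (λ t → leaves (trace t)) q))
        (tokens-suc (trace (q % T)) (q / T))))

  states : ∀ v p → x v p + shift T (s′ v) p ≡ sN v p + sO v p
  states v p with shift-view T p
  ... | inj₁ (p<T , z) = trans (cong (x v p +_) (z (s′ v))) (trans (+-identityʳ _) (sym (trans
        (cong₂ _+_ (lay-low (λ t → before (trace t) v) p<T) (lay-low (λ t → final (trace t) v) p<T))
        (state-zero (trace p) v))))
  ... | inj₂ (q , refl , z) = trans (cong₂ _+_ (off v (T + q) (m-high q)) (z (s′ v))) (sym (trans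
        (cong₂ _+_ (lay-high (λ t → before (trace t) v) q) (lay-high (λ t → final (trace t) v) q))
        (state-suc (trace (q % T)) v (q / T))))

  maxLen : Σ ℕ λ b → ∀ t → t < T → len (trace t) ≤ b
  maxLen = maxBelow (λ t → len (trace t)) T

  horizon : ℕ
  horizon = proj₁ maxLen * T

  beyond : ∀ p → horizon ≤ p → n p ≡ 0 × o p ≡ 0
  beyond p l = len-≤ (trace (p % T)) (p / T) (≤-trans (proj₂ maxLen (p % T) (m%n<n p T))
    (subst (_≤ p / T) (m*n/n≡m (proj₁ maxLen) T) (/-monoˡ-≤ T l)))

  sN-off : ∀ v p → n p ≡ 0 → sN v p ≡ 0
  sN-off v p = before-off (trace (p % T)) v (p / T)

  s′-off : ∀ v p → n p ≡ 0 → s′ v p ≡ 0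
  s′-off v p = after-off (trace (p % T)) v (p / T)

  sO-off : ∀ v p → o p ≡ 0 → sO v p ≡ 0
  sO-off v p = final-off (trace (p % T)) v (p / T)

  n-on : ∀ p → n p ≡ 1 → R (λ v → sN v p) (λ v → s′ v p)
  n-on p = goes-on (trace (p % T)) (p / T)

  o-on : ∀ p → o p ≡ 1 → E (λ v → sO v p)
  o-on p = leaves-on (trace (p % T)) (p / T)

  bodySparse : Sparse n [ sN , s′ ] horizon
  bodySparse = record { m≤1 = n≤1 ; finite = λ p l → proj₁ (beyond p l)
                      ; off = λ { (inj₁ v) → sN-off v ; (inj₂ v) → s′-off v } }

  exitSparse : Sparse o sO horizon
  exitSparse = record { m≤1 = o≤1 ; finite = λ p l → proj₂ (beyond p l) ; off = sO-off }

  registers : LoopVar V → ℕ → ℕ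
  -- `T₀` and `D` are no digit sequences; the zeros are placeholders for them, and `ys` gives them
  -- their values directly.
  registers (inj₁ i)                 = lookup (const0 ∷ const0 ∷ n ∷ o ∷ []) i
    where
    const0 : ℕ → ℕ
    const0 _ = 0
  registers (inj₂ (inj₁ v))        = sN v
  registers (inj₂ (inj₂ (inj₁ v))) = sO v
  registers (inj₂ (inj₂ (inj₂ v))) = s′ v

  registers-finite : ∀ y p → horizon ≤ p → registers y p ≡ 0
  registers-finite (inj₁ 0F) p l = refl
  registers-finite (inj₁ 1F) p l = refl
  registers-finite (inj₁ 2F) p l = proj₁ (beyond p l)
  registers-finite (inj₁ 3F) p l = proj₂ (beyond p l)
  registers-finite (inj₂ (inj₁ v))        p l = sN-off v p (proj₁ (beyond p l))
  registers-finite (inj₂ (inj₂ (inj₁ v))) p l = sO-off v p (proj₂ (beyond p l))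
  registers-finite (inj₂ (inj₂ (inj₂ v))) p l = s′-off v p (proj₁ (beyond p l))

  κ : ℕ
  κ = proj₁ (bounded (finite-LoopVar fin) registers horizon registers-finite)

  registers-≤κ : ∀ y p → registers y p ≤ κ
  registers-≤κ = proj₂ (bounded (finite-LoopVar fin) registers horizon registers-finite)

  module Encode (K w : ℕ) (base : 2 ^ w ≡ Digits.B K) (κ≤K : κ ≤ K) {M : ℕ} {X : V → ℕ}
                (rep : Represents K M X m x) where
    open Digits K
    open Represents rep

    K<B : ∀ {a} → a ≤ K → a < B
    K<B l = ≤-<-trans l (m<n⇒m<1+n (s≤s (m≤m+n K K)))

    ys : LoopVar V → ℕ
    ys (inj₁ 0F) = T₀
    ys (inj₁ 1F) = 2 ^ (w * (1 + T₀))
    ys y         = num (registers y) horizon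

    open LoopVars ys

    enc : ∀ y p → dig (num (registers y) horizon) p ≡ registers y p
    enc y = dig-num (registers y) horizon (λ p → K<B (≤-trans (registers-≤κ y p) κ≤K)) (registers-finite y)

    N-dig : ∀ p → dig N p ≡ n p
    N-dig = enc (inj₁ 2F)

    O-dig : ∀ p → dig O p ≡ o p
    O-dig = enc (inj₁ 3F)

    D≡B^T : D ≡ B ^ T
    D≡B^T = trans (sym (^-*-assoc 2 w T)) (cong (_^ T) base)

    dig-D* : ∀ C {z} → (∀ p → dig C p ≡ z p) → ∀ p → dig (D * C) p ≡ shift T z p
    dig-D* C {z} h p = trans (trans (cong (λ d → dig (d * C) p) D≡B^T) (dig-shift T C p)) shift-cong
      where
      shift-cong : shift T (dig C) p ≡ shift T z p
      shift-cong with shift-view T p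
      ... | inj₁ (_ , e)     = trans (e (dig C)) (sym (e z))
      ... | inj₂ (q , _ , e) = trans (e (dig C)) (trans (h q) (sym (e z)))

    -- Digits can be added because the sums are digits of the right-hand side, or at most K.
    sum-eq : ∀ {X₁ X₂ Y₁ Y₂} {x₁ x₂ y₁ y₂ : ℕ → ℕ} →
      (∀ p → dig X₁ p ≡ x₁ p) → (∀ p → dig X₂ p ≡ x₂ p) → (∀ p → dig Y₁ p ≡ y₁ p) → (∀ p → dig Y₂ p ≡ y₂ p) →
      (∀ p → x₁ p + x₂ p ≡ y₁ p + y₂ p) → (∀ p → y₁ p + y₂ p < B) → X₁ + X₂ ≡ Y₁ + Y₂
    sum-eq {X₁} {X₂} {Y₁} {Y₂} d₁ d₂ e₁ e₂ eq small = dig-ext λ p → begin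
      dig (X₁ + X₂) p         ≡⟨ dig-+ X₁ X₂ (λ p → subst (_< B)
                                     (sym (trans (cong₂ _+_ (d₁ p) (d₂ p)) (eq p))) (small p)) p ⟩
      dig X₁ p + dig X₂ p     ≡⟨ cong₂ _+_ (d₁ p) (d₂ p) ⟩
      _                       ≡⟨ eq p ⟩
      _                       ≡⟨ cong₂ _+_ (e₁ p) (e₂ p) ⟨
      dig Y₁ p + dig Y₂ p     ≡⟨ dig-+ Y₁ Y₂ (λ p → subst (_< B) (sym (cong₂ _+_ (e₁ p) (e₂ p))) (small p)) p ⟨
      dig (Y₁ + Y₂) p         ∎
      where open ≡-Reasoning

    n+o≤1 : ∀ p → n p + o p ≤ 1
    n+o≤1 p with p / T
    ... | zero  = subst (_≤ 1) (sym (tokens-zero (trace (p % T)))) (m≤1 (p % T))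
    ... | suc j = subst (_≤ 1) (sym (tokens-suc (trace (p % T)) j)) (goes-≤1 (trace (p % T)) j)

    n+o<B : ∀ p → n p + o p < B
    n+o<B p = ≤-<-trans (n+o≤1 p) (s≤s (s≤s z≤n))

    -- A position holds a token that goes on or one that leaves, never both, so one of the summands
    -- is 0.
    sN+sO<B : ∀ v p → sN v p + sO v p < B
    sN+sO<B v p with m≤1-cases (n≤1 p)
    ... | inj₁ e = K<B (subst (_≤ K) (cong (_+ sO v p) (sym (sN-off v p e)))
            (≤-trans (registers-≤κ (inj₂ (inj₂ (inj₁ v))) p) κ≤K))
    ... | inj₂ e = K<B (subst (_≤ K) (sym (trans (cong (sN v p +_) (sO-off v p o≡0)) (+-identityʳ _)))
            (≤-trans (registers-≤κ (inj₂ (inj₁ v)) p) κ≤K))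
      where
      o≡0 : o p ≡ 0
      o≡0 = n≤0⇒n≡0 (s≤s⁻¹ (subst (_≤ 1) (cong (_+ o p) e) (n+o≤1 p)))

    L≡ : N + O ≡ M + D * N
    L≡ = sym (sum-eq {X₁ = M} {D * N} {N} {O} M-dig (dig-D* N N-dig) N-dig O-dig tokens n+o<B)

    L-dig : ∀ p → dig (N + O) p ≡ n p + o p
    L-dig p = trans (dig-+ N O (λ p → subst (_< B) (sym (cong₂ _+_ (N-dig p) (O-dig p))) (n+o<B p)) p)
                    (cong₂ _+_ (N-dig p) (O-dig p))

    ≤1-⊑ : ∀ {a b} → a ≤ b → b ≤ 1 → a ⊑ b
    ≤1-⊑ {zero}  {b}     _         _         = oddC-zero b
    ≤1-⊑ {suc a} {suc b} (s≤s z≤n) (s≤s z≤n) = refl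

    ⊑L : ∀ A {a : ℕ → ℕ} → (∀ p → dig A p ≡ a p) → (∀ p → a p ≤ n p + o p) → A ⊑ N + O
    ⊑L A h l = dig-⊑⇒⊑ w base λ p →
      subst₂ _⊑_ (sym (h p)) (sym (L-dig p)) (≤1-⊑ (l p) (n+o≤1 p))

    supported : ∀ A C {a z : ℕ → ℕ} → (∀ p → dig A p ≡ a p) → (∀ p → dig C p ≡ z p) →
      (∀ p → a p ≤ 1) → (∀ p → a p ≡ 0 → z p ≡ 0) → (∀ p → z p ≤ K) → C ⊑ K * A
    supported A C {a} {z} hA hZ a≤1 z-off z≤K = dig-≤⇒⊑K w base A C
      (λ p → subst (_≤ 1) (sym (hA p)) (a≤1 p))
      (λ p → subst₂ (λ z a → z ≤ K * a) (sym (hZ p)) (sym (hA p)) (lemma (m≤1-cases (a≤1 p)) (z-off p) (z≤K p)))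
      where
      lemma : ∀ {a z} → a ≡ 0 ⊎ a ≡ 1 → (a ≡ 0 → z ≡ 0) → z ≤ K → z ≤ K * a
      lemma (inj₁ e) off l = subst (_≤ _) (sym (off e)) z≤n
      lemma (inj₂ refl) off l = subst (_ ≤_) (sym (*-identityʳ K)) l

    loopNumbers : Loop.LoopNumbers K w base M X ys
    loopNumbers = record
      { D≡  = refl
      ; L≡  = L≡
      ; M⊑  = subst (M ⊑_) L≡ (⊑L M M-dig λ p → subst (m p ≤_) (tokens p) (m≤m+n (m p) _))
      ; N⊑  = ⊑L N N-dig λ p → m≤m+n (n p) (o p)
      ; S≡  = λ v → sum-eq {X₁ = X v} {D * S′ v} {SN v} {SO v}
                (X-dig v) (dig-D* (S′ v) (enc (inj₂ (inj₂ (inj₂ v)))))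
                (enc (inj₂ (inj₁ v))) (enc (inj₂ (inj₂ (inj₁ v)))) (states v) (sN+sO<B v)
      ; SN⊑ = λ v → supported N (SN v) N-dig (enc (inj₂ (inj₁ v))) n≤1 (sN-off v)
                (λ p → ≤-trans (registers-≤κ (inj₂ (inj₁ v)) p) κ≤K)
      ; SO⊑ = λ v → supported O (SO v) O-dig (enc (inj₂ (inj₂ (inj₁ v)))) o≤1 (sO-off v)
                (λ p → ≤-trans (registers-≤κ (inj₂ (inj₂ (inj₁ v))) p) κ≤K)
      ; S′⊑ = λ v → supported N (S′ v) N-dig (enc (inj₂ (inj₂ (inj₂ v)))) n≤1 (s′-off v)
                (λ p → ≤-trans (registers-≤κ (inj₂ (inj₂ (inj₂ v))) p) κ≤K)
      }

    bodyRep : Represents K N [ SN , S′ ] n [ sN , s′ ]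
    bodyRep = represents N-dig λ { (inj₁ v) → enc (inj₂ (inj₁ v)) ; (inj₂ v) → enc (inj₂ (inj₂ (inj₂ v))) }

    exitRep : Represents K O SO o sO
    exitRep = represents O-dig λ v → enc (inj₂ (inj₂ (inj₁ v)))

-- Completeness of the parallel execution

record ParallelComplete {V : Set} (f : Finite V) (R : Rel V) (m : ℕ → ℕ) (x : V → ℕ → ℕ) : Set₁ where
  constructor complete
  field
    -- The base must exceed the registers of all nested loops. Runs are therefore kept as functions
    -- of the position, and every sufficiently large `K` is allowed; the base is fixed only at the
    -- very end.
    threshold : ℕ
    sat : ∀ {W : Set} {σ : W → ℕ} {wT KT MT : Tm W} {XT : V → Tm W} {w K M : ℕ} {X : V → ℕ} →
      Values σ wT KT MT XT w K M X → threshold ≤ K → Represents K M X m x →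
      Sat σ (parallel f R wT KT MT XT)

parallel-complete : {V : Set} (f : Finite V) (R : Rel V) {m : ℕ → ℕ} {x : V → ℕ → ℕ} {τ : ℕ} → Sparse m x τ →
  (∀ t → m t ≡ 1 → Sem R (λ v → x v t)) → ParallelComplete f R m x
parallel-complete f (zer v) {m} {x} sp sem = complete 0 λ { {K = K} (values w≡ K≡ M≡ X≡ b) _ (represents M-dig X-dig) →
  trans (X≡ v) (Digits.dig-ext K λ t → trans (X-dig v t) (trans (zero-at t) (sym (Digits.dig-0 K t)))) }
  where
  open Sparse sp
  zero-at : ∀ t → x v t ≡ 0
  zero-at t with m≤1-cases (m≤1 t)
  ... | inj₁ e = off v t e
  ... | inj₂ e = sem t e
parallel-complete f (suk u v) {m} {x} sp sem = complete 0 λ { {K = K} {M} {X} (values w≡ K≡ M≡ X≡ b) _ (represents M-dig X-dig) →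
  let open Digits K in
  trans (X≡ u) (trans
    (dig-ext λ t → trans (X-dig u t) (trans (eq t) (trans (cong₂ _+_ (sym (X-dig v t)) (sym (M-dig t)))
      (sym (dig-+ (X v) M (λ t → subst (_< B)
        (trans (X-dig u t) (trans (eq t) (cong₂ _+_ (sym (X-dig v t)) (sym (M-dig t))))) (dig<B (X u) t)) t)))))
    (sym (cong₂ _+_ (X≡ v) M≡))) }
  where
  open Sparse sp
  eq : ∀ t → x u t ≡ x v t + m t
  eq t with m≤1-cases (m≤1 t)
  ... | inj₁ e = trans (off u t e) (sym (cong₂ _+_ (off v t e) e))
  ... | inj₂ e = trans (sem t e) (trans (+-comm 1 (x v t)) (cong (x v t +_) (sym e)))
parallel-complete f (eqv u v) {m} {x} sp sem = complete 0 λ { {K = K} (values w≡ K≡ M≡ X≡ b) _ (represents M-dig X-dig) →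
  trans (X≡ u) (trans (Digits.dig-ext K λ t → trans (X-dig u t) (trans (eq t) (sym (X-dig v t)))) (sym (X≡ v))) }
  where
  open Sparse sp
  eq : ∀ t → x u t ≡ x v t
  eq t with m≤1-cases (m≤1 t)
  ... | inj₁ e = trans (off u t e) (sym (off v t e))
  ... | inj₂ e = sem t e
parallel-complete f (Q & R) sp sem
  with parallel-complete f Q sp (λ t e → proj₁ (sem t e)) | parallel-complete f R sp (λ t e → proj₂ (sem t e))
... | complete κ₁ s₁ | complete κ₂ s₂ = complete (κ₁ ⊔ κ₂) λ vals l rep →
  s₁ vals (≤-trans (m≤m⊔n κ₁ κ₂) l) rep , s₂ vals (≤-trans (m≤n⊔m κ₁ κ₂) l) rep
parallel-complete {V} f (exs k R) {m} {x} {τ} sp sem = complete (threshold ⊔ κ)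
  λ { {wT = wT} {KT} {MT} {XT} {w} {K} {M} {X} (values w≡ K≡ M≡ X≡ b) l (represents M-dig X-dig) →
  let open Digits K
      κ≤K   = ≤-trans (m≤n⊔m threshold κ) l
      ys    = λ i → num (y i) τ
      y≤K   = λ i t → ≤-trans (proj₂ bnd i t) κ≤K
      K<B   = λ {a} (l : a ≤ K) → ≤-<-trans l (m<n⇒m<1+n (s≤s (m≤m+n K K)))
      y-dig = λ i → dig-num (y i) τ (λ t → K<B (y≤K i t)) (λ t l → y-off i t (finite t l))
      mask  = λ t → subst (_≤ 1) (sym (M-dig t)) (m≤1 t)
  in ys ,
  all-complete (finite-Fin k) _ (λ i → maskForm-complete
    (subst (ys i ⊑_) (sym (cong₂ _*_ (trans (ev-wk KT) K≡) (trans (ev-wk MT) M≡)))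
      (dig-≤⇒⊑K w b M (ys i) mask λ t → subst₂ (λ z a → z ≤ K * a) (sym (y-dig i t)) (sym (M-dig t))
        (supported (m≤1-cases (m≤1 t)) (y-off i t) (y≤K i t))))) ,
  sat {X = [ X , ys ]}
    (values (trans (ev-wk wT) w≡) (trans (ev-wk KT) K≡) (trans (ev-wk MT) M≡)
            (λ { (inj₁ v) → trans (ev-wk (XT v)) (X≡ v) ; (inj₂ i) → refl }) b)
    (≤-trans (m≤m⊔n threshold κ) l)
    (represents M-dig λ { (inj₁ v) → X-dig v ; (inj₂ i) → y-dig i }) }
  where
  open Sparse sp
  -- Witnesses exist only at marked positions; elsewhere 0 is chosen, as the mask condition on the
  -- new variables demands.
  choice : ∀ t → Σ (Fin k → ℕ) λ ys → (m t ≡ 0 → ∀ i → ys i ≡ 0) × (m t ≡ 1 → Sem R [ (λ v → x v t) , ys ])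
  choice t with m≤1-cases (m≤1 t)
  ... | inj₁ e = (λ _ → 0) , (λ _ _ → refl) , λ e′ → ⊥-elim (1+n≢0 (trans (sym e′) e))
  ... | inj₂ e = proj₁ (sem t e) , (λ e′ → ⊥-elim (1+n≢0 (trans (sym e) e′))) , λ _ → proj₂ (sem t e)
  y : Fin k → ℕ → ℕ
  y i t = proj₁ (choice t) i
  y-off : ∀ i t → m t ≡ 0 → y i t ≡ 0
  y-off i t e = proj₁ (proj₂ (choice t)) e i
  bnd : Σ ℕ λ κ → ∀ i t → y i t ≤ κ
  bnd = bounded (finite-Fin k) y τ λ i t l → y-off i t (finite t l)
  κ : ℕ
  κ = proj₁ bnd
  supported : ∀ {a z K} → a ≡ 0 ⊎ a ≡ 1 → (a ≡ 0 → z ≡ 0) → z ≤ K → z ≤ K * a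
  supported (inj₁ e) off l = subst (_≤ _) (sym (off e)) z≤n
  supported {K = K} (inj₂ refl) off l = subst (_ ≤_) (sym (*-identityʳ K)) l
  extended : ParallelComplete (finite-⊎ f (finite-Fin k)) R m [ x , y ]
  extended = parallel-complete (finite-⊎ f (finite-Fin k)) R {x = [ x , y ]} {τ}
    (record { m≤1 = m≤1 ; finite = finite ; off = λ { (inj₁ v) → off v ; (inj₂ i) → y-off i } })
    (λ t e → Sem-cong R (λ { (inj₁ v) → refl ; (inj₂ i) → refl }) (proj₂ (proj₂ (choice t)) e))
  open ParallelComplete extended
parallel-complete {V} f (loop R E) {m} {x} {τ} sp sem = complete (κ ⊔ (B.threshold ⊔ X.threshold))
  λ { {wT = wT} {KT} {w = w} {K} vals@(values w≡ K≡ M≡ X≡ b) l rep →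
  let module Enc = Encode K w b (≤-trans (m≤m⊔n κ _) l) rep
      l′ = ≤-trans (m≤n⊔m κ _) l
  in loopForm-complete f vals Enc.ys Enc.loopNumbers
    (B.sat (values (trans (ev-wk wT) w≡) (trans (ev-wk KT) K≡) refl (λ { (inj₁ v) → refl ; (inj₂ v) → refl }) b)
      (≤-trans (m≤m⊔n B.threshold _) l′) Enc.bodyRep)
    (X.sat (values (trans (ev-wk wT) w≡) (trans (ev-wk KT) K≡) refl (λ _ → refl) b)
      (≤-trans (m≤n⊔m B.threshold _) l′) Enc.exitRep) }
  where
  trace : ∀ t → Trace (λ s s′ → Sem R [ s , s′ ]) (Sem E) (m t) (λ v → x v t)
  trace t with m t | Sparse.m≤1 sp t | Sparse.off sp | sem t | (λ v → Sparse.off sp v t)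
  ... | .0 | z≤n       | _ | _ | off = none (λ v → off v refl)
  ... | .1 | (s≤s z≤n) | _ | s | _   = fromIter (s refl)
  open LoopLayout f m x τ sp trace
  body : ParallelComplete (finite-⊎ f f) R n [ sN , s′ ]
  body = parallel-complete (finite-⊎ f f) R bodySparse
    (λ p e → Sem-cong R (λ { (inj₁ v) → refl ; (inj₂ v) → refl }) (n-on p e))
  exit : ParallelComplete f E o sO
  exit = parallel-complete f E exitSparse o-on
  module B = ParallelComplete body
  module X = ParallelComplete exit

-- Graphs of partial recursive functions

-- A frame condition: an iteration relates two arbitrary states, so registers that do not change
-- must be copied explicitly.
keep : {U : Set} {n : ℕ} → Vec U n → Rel (U ⊎ U) → Rel (U ⊎ U)
keep []       Q = Q
keep (v ∷ vs) Q = eqv (inj₂ v) (inj₁ v) & keep vs Q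

keep-sound : {U : Set} {n : ℕ} (vs : Vec U n) {Q : Rel (U ⊎ U)} {s s′ : U → ℕ} →
  Sem (keep vs Q) [ s , s′ ] → map s′ vs ≡ map s vs × Sem Q [ s , s′ ]
keep-sound []       q       = refl , q
keep-sound (v ∷ vs) (e , q) with keep-sound vs q
... | es , q′ = cong₂ _∷_ e es , q′

keep-complete : {U : Set} {n : ℕ} (vs : Vec U n) {Q : Rel (U ⊎ U)} {s s′ : U → ℕ} →
  (∀ i → s′ (lookup vs i) ≡ s (lookup vs i)) → Sem Q [ s , s′ ] → Sem (keep vs Q) [ s , s′ ]
keep-complete []       h q = q
keep-complete (v ∷ vs) h q = h 0F , keep-complete vs (h ∘ fsuc) q

wks : {V F : Set} {a : ℕ} → Vec V a → Vec (V ⊎ F) a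
wks = map inj₁

map-wks : {V F : Set} {a : ℕ} {e : V → ℕ} {ys : F → ℕ} (xs : Vec V a) → map [ e , ys ] (wks xs) ≡ map e xs
map-wks []       = refl
map-wks (x ∷ xs) = cong (_ ∷_) (map-wks xs)

map-var : {V : Set} {e : V → ℕ} {k : ℕ} (ys : Fin k → ℕ) → map [ e , ys ] (tabulate inj₂) ≡ tabulate ys
map-var {e = e} ys = sym (tabulate-∘ [ e , ys ] inj₂)

lookupV-map : {A : Set} {a : ℕ} (e : A → ℕ) (xs : Vec A a) (i : Fin a) → lookupV (map e xs) i ≡ e (lookupV xs i)
lookupV-map e (x ∷ xs) fzero    = refl
lookupV-map e (x ∷ xs) (fsuc i) = lookupV-map e xs i

mutual
  -- For `prec`, `i` counts up from 0 to the argument while `r` holds the value at `i`. For `mu`,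
  -- the counter climbs and each iteration exhibits a nonzero value of `f`: the universal quantifier
  -- of `emu` becomes the chain of iterations.
  graph : {V : Set} {a : ℕ} → PR a → V → Vec V a → Rel V
  graph Z           y []       = zer y
  graph S           y (x ∷ []) = suk y x
  graph (proj i)    y xs       = eqv y (lookupV xs i)
  graph (comp {b = b} f gs) y xs =
    exs b (graphs gs (tabulate inj₂) (wks xs) (graph f (inj₁ y) (tabulate inj₂)))
  graph (prec f g) y (n ∷ xs) = exs 2 (zer i & graph f r (wks xs) & loop (precStep g y n xs) (eqv i (inj₁ n) & eqv r (inj₁ y)))
    where
    i = inj₂ 0F
    r = inj₂ 1F
  graph (mu f) y xs = exs 1 (zer (inj₂ 0F) & loop (muStep f y xs) (muExit f y xs))

  graphs : {V : Set} {a b : ℕ} → Vec (PR a) b → Vec V b → Vec V a → Rel V → Rel V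
  graphs []       []       xs Q = Q
  graphs (g ∷ gs) (y ∷ ys) xs Q = graph g y xs & graphs gs ys xs Q

  precStep : {V : Set} {a : ℕ} → PR (suc (suc a)) → V → V → Vec V a → Rel ((V ⊎ Fin 2) ⊎ (V ⊎ Fin 2))
  precStep g y n xs = suk (inj₂ i) (inj₁ i) & graph g (inj₂ r) (inj₁ i ∷ inj₁ r ∷ wks (wks xs)) &
                      -- The last `eqv` is trivially true and only closes the conjunction.
                      keep (inj₁ y ∷ inj₁ n ∷ wks xs) (eqv (inj₁ i) (inj₁ i))
    where
    i = inj₂ 0F
    r = inj₂ 1F

  muStep : {V : Set} {a : ℕ} → PR (suc a) → V → Vec V a → Rel ((V ⊎ Fin 1) ⊎ (V ⊎ Fin 1))
  muStep f y xs = keep (inj₁ y ∷ wks xs)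
    ( suk (inj₂ (inj₂ 0F)) (inj₁ (inj₂ 0F))
    -- The two new variables are the value of `f` at the counter and its predecessor, which
    -- witnesses that the value is not 0.
    & exs 2 (suk (inj₂ 0F) (inj₂ 1F) & graph f (inj₂ 0F) (inj₁ (inj₁ (inj₂ 0F)) ∷ wks (wks (wks xs)))))

  muExit : {V : Set} {a : ℕ} → PR (suc a) → V → Vec V a → Rel (V ⊎ Fin 1)
  muExit f y xs = eqv (inj₂ 0F) (inj₁ y) & exs 1 (zer (inj₂ 0F) & graph f (inj₂ 0F) (inj₁ (inj₂ 0F) ∷ wks (wks xs)))

mutual
  graph-sound : {V : Set} {a : ℕ} (f : PR a) (y : V) (xs : Vec V a) {e : V → ℕ} →
    Sem (graph f y xs) e → Eval f (map e xs) (e y)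
  graph-sound Z y [] p = subst (Eval Z []) (sym p) eZ
  graph-sound S y (x ∷ []) p = subst (Eval S _) (sym p) (eS _)
  graph-sound (proj i) y xs {e} p =
    subst (Eval (proj i) (map e xs)) (trans (lookupV-map e xs i) (sym p)) (eproj i (map e xs))
  graph-sound (comp f gs) y xs {e} (ys , p) with graphs-sound gs (tabulate inj₂) (wks xs) p
  ... | ps , q = ecomp (subst₂ (EvalV gs) (map-wks xs) (map-var ys) ps)
                       (subst (λ v → Eval f v (e y)) (map-var ys) (graph-sound f _ _ q))
  graph-sound (prec f g) y (n ∷ xs) {e} (ir , i≡0 , p , it) =
    prec-sound f g y n xs it refl refl (map-wks xs)
      (subst₂ (λ i v → Eval (prec f g) (i ∷ v) (ir 1F)) (sym i≡0) (map-wks xs) (eprec0 (graph-sound f _ _ p)))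
  graph-sound (mu f) y xs {e} (z , z≡0 , it) =
    mu-sound f y xs it refl (map-wks xs) (λ w w<z → ⊥-elim (n≮0 (subst (w <_) z≡0 w<z)))

  graphs-sound : {V : Set} {a b : ℕ} (gs : Vec (PR a) b) (ys : Vec V b) (xs : Vec V a) {Q : Rel V} {e : V → ℕ} →
    Sem (graphs gs ys xs Q) e → EvalV gs (map e xs) (map e ys) × Sem Q e
  graphs-sound []       []       xs q       = [] , q
  graphs-sound (g ∷ gs) (y ∷ ys) xs (p , q) with graphs-sound gs ys xs q
  ... | ps , q′ = graph-sound g y xs p ∷ ps , q′

  -- Loop invariant: the register `inj₂ 1F` is the value of the recursion at the counter `inj₂ 0F`,
  -- while the output, the bound and the arguments stay fixed.
  prec-sound : {V : Set} {a : ℕ} (f : PR a) (g : PR (suc (suc a))) (y n : V) (xs : Vec V a)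
    {s : V ⊎ Fin 2 → ℕ} {r m : ℕ} {ws : Vec ℕ a} →
    Iter (λ s s′ → Sem (precStep g y n xs) [ s , s′ ])
         (Sem (eqv (inj₂ 0F) (inj₁ n) & eqv (inj₂ 1F) (inj₁ y))) s →
    s (inj₁ y) ≡ r → s (inj₁ n) ≡ m → map s (wks xs) ≡ ws →
    Eval (prec f g) (s (inj₂ 0F) ∷ ws) (s (inj₂ 1F)) → Eval (prec f g) (m ∷ ws) r
  prec-sound f g y n xs {ws = ws} (done (i≡n , r≡y)) hy hn hxs ev =
    subst₂ (λ i r → Eval (prec f g) (i ∷ ws) r) (trans i≡n hn) (trans r≡y hy) ev
  prec-sound f g y n xs {s} {ws = ws} (step {s′ = s′} (i≡ , p , kept) it) hy hn hxs ev
    with keep-sound (inj₁ y ∷ inj₁ n ∷ wks xs) kept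
  ... | es , _ = prec-sound f g y n xs it
    (trans (cong Vec.head es) hy) (trans (cong (Vec.head ∘ Vec.tail) es) hn)
    (trans (cong (Vec.tail ∘ Vec.tail) es) hxs)
    (subst (λ i → Eval (prec f g) (i ∷ ws) (s′ (inj₂ 1F))) (sym i≡)
      (eprecS ev (subst (λ v → Eval g (s (inj₂ 0F) ∷ s (inj₂ 1F) ∷ v) (s′ (inj₂ 1F)))
        (trans (map-wks (wks xs)) hxs) (graph-sound g _ _ p))))

  mu-sound : {V : Set} {a : ℕ} (f : PR (suc a)) (y : V) (xs : Vec V a)
    {s : V ⊎ Fin 1 → ℕ} {r : ℕ} {ws : Vec ℕ a} →
    Iter (λ s s′ → Sem (muStep f y xs) [ s , s′ ]) (Sem (muExit f y xs)) s →
    s (inj₁ y) ≡ r → map s (wks xs) ≡ ws →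
    (∀ z → z < s (inj₂ 0F) → Σ ℕ λ w → Eval f (z ∷ ws) (suc w)) → Eval (mu f) ws r
  mu-sound f y xs {s} {r} {ws} (done (z≡y , u , u≡0 , p)) hy hxs below =
    subst (Eval (mu f) ws) (trans z≡y hy) (emu
      (subst₂ (λ v u → Eval f (s (inj₂ 0F) ∷ v) u) (trans (map-wks (wks xs)) hxs) u≡0 (graph-sound f _ _ p))
      below)
  mu-sound f y xs {s} {r} {ws} (step {s′ = s′} st it) hy hxs below
    with keep-sound (inj₁ y ∷ wks xs) st
  ... | es , z≡ , u , u≡ , p = mu-sound f y xs it
    (trans (cong Vec.head es) hy) (trans (cong Vec.tail es) hxs) below′
    where
    below′ : ∀ z → z < s′ (inj₂ 0F) → Σ ℕ λ w → Eval f (z ∷ ws) (suc w)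
    below′ z l with m≤n⇒m<n∨m≡n (s≤s⁻¹ (subst (z <_) z≡ l))
    ... | inj₁ z<    = below z z<
    ... | inj₂ refl = u 1F , subst₂ (λ v u → Eval f (s (inj₂ 0F) ∷ v) u)
      (trans (map-wks (wks (wks xs))) (trans (map-wks (wks xs)) hxs)) u≡ (graph-sound f _ _ p)

mutual
  graph-complete : {V : Set} {a : ℕ} {f : PR a} {ws : Vec ℕ a} {r : ℕ} → Eval f ws r →
    (y : V) (xs : Vec V a) {e : V → ℕ} → map e xs ≡ ws → e y ≡ r → Sem (graph f y xs) e
  graph-complete eZ y [] hx hy = hy
  graph-complete (eS _) y (x ∷ []) refl hy = hy
  graph-complete (eproj i _) y xs {e} refl hy = trans hy (lookupV-map e xs i)
  graph-complete (ecomp {ys = ys} ps p) y xs hx hy = lookup ys ,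
    graphs-complete ps (tabulate inj₂) (wks xs) (trans (map-wks xs) hx) ys≡ (graph-complete p _ _ ys≡ hy)
    where
    ys≡ : map [ _ , lookup ys ] (tabulate inj₂) ≡ ys
    ys≡ = trans (map-var (lookup ys)) (tabulate∘lookup ys)
  graph-complete (eprec0 p) y (n ∷ xs) hx hy = prec-complete (eprec0 p) y n xs hx hy
  graph-complete (eprecS p q) y (n ∷ xs) hx hy = prec-complete (eprecS p q) y n xs hx hy
  graph-complete (emu {f = f} {xs = ws} {y = r} p below) y xs {e} hx hy = (λ _ → 0) , refl , search r 0 (+-identityʳ r)
    where
    state : ℕ → _ ⊎ Fin 1 → ℕ
    state z = [ e , (λ _ → z) ]
    args : ∀ {F : Set} {z} {u : F → ℕ} → map [ state z , u ] (wks (wks xs)) ≡ ws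
    args = trans (map-wks (wks xs)) (trans (map-wks xs) hx)
    search : ∀ k z → k + z ≡ r → Iter (λ s s′ → Sem (muStep f y xs) [ s , s′ ]) (Sem (muExit f y xs)) (state z)
    search zero    z refl = done (sym hy , (λ _ → 0) , refl , graph-complete p _ _ (cong (z ∷_) args) refl)
    search (suc k) z e′ with below z (subst (z <_) e′ (s≤s (m≤n+m z k)))
    ... | w , q = step {s′ = state (suc z)}
      (keep-complete (inj₁ y ∷ wks xs) kept
        (refl , lookup (suc w ∷ w ∷ []) , refl ,
          graph-complete q _ _ (cong (z ∷_) (trans (map-wks (wks (wks xs))) args)) refl))
      (search k (suc z) (trans (+-suc k z) e′))
      where
      kept : ∀ i → state (suc z) (lookup (inj₁ y ∷ wks xs) i) ≡ state z (lookup (inj₁ y ∷ wks xs) i)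
      kept 0F       = refl
      kept (fsuc i) = lookup-wks xs i

  graphs-complete : {V : Set} {a b : ℕ} {gs : Vec (PR a) b} {ws : Vec ℕ a} {rs : Vec ℕ b} → EvalV gs ws rs →
    (ys : Vec V b) (xs : Vec V a) {Q : Rel V} {e : V → ℕ} → map e xs ≡ ws → map e ys ≡ rs → Sem Q e →
    Sem (graphs gs ys xs Q) e
  graphs-complete []       []       xs hx hy q = q
  graphs-complete (p ∷ ps) (y ∷ ys) xs hx hy q =
    graph-complete p y xs hx (cong Vec.head hy) , graphs-complete ps ys xs hx (cong Vec.tail hy) q

  lookup-wks : {V F : Set} {a : ℕ} {e : V → ℕ} {u u′ : F → ℕ} (xs : Vec V a) (i : Fin a) →
    [ e , u ] (lookup (wks xs) i) ≡ [ e , u′ ] (lookup (wks xs) i)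
  lookup-wks (x ∷ xs) fzero    = refl
  lookup-wks (x ∷ xs) (fsuc i) = lookup-wks xs i

  -- The derivation descends from `m` to 0 whereas the loop counts upwards, so `unwind` accumulates
  -- the run from its last iteration backwards.
  prec-complete : {V : Set} {a : ℕ} {f : PR a} {g : PR (suc (suc a))} {m : ℕ} {ws : Vec ℕ a} {r : ℕ} →
    Eval (prec f g) (m ∷ ws) r → (y n : V) (xs : Vec V a) {e : V → ℕ} →
    map e (n ∷ xs) ≡ m ∷ ws → e y ≡ r → Sem (graph (prec f g) y (n ∷ xs)) e
  prec-complete {V} {f = f} {g} {ws = ws} p y n xs {e} hx hy with unwind p (done (sym (cong Vec.head hx) , sym hy))
    where
    state : ℕ → ℕ → V ⊎ Fin 2 → ℕ
    state i r = [ e , lookup (i ∷ r ∷ []) ]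
    Run : ℕ → ℕ → Set
    Run i r = Iter (λ s s′ → Sem (precStep g y n xs) [ s , s′ ])
                   (Sem (eqv (inj₂ 0F) (inj₁ n) & eqv (inj₂ 1F) (inj₁ y))) (state i r)
    unwind : ∀ {i r} → Eval (prec f g) (i ∷ ws) r → Run i r →
      Σ ℕ λ r₀ → Sem (graph f (inj₂ 1F) (wks xs)) (state 0 r₀) × Run 0 r₀
    unwind (eprec0 {z = r} p) run = r , graph-complete p _ _ (trans (map-wks xs) (cong Vec.tail hx)) refl , run
    unwind (eprecS {t = i} {r} {r′} p q) run = unwind p (step
      (refl ,
       graph-complete q _ _ (cong (λ v → i ∷ r ∷ v) (trans (map-wks (wks xs)) (trans (map-wks xs) (cong Vec.tail hx)))) refl ,
       keep-complete (inj₁ y ∷ inj₁ n ∷ wks xs)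
         (λ { 0F → refl ; (fsuc 0F) → refl ; (fsuc (fsuc j)) → lookup-wks xs j }) refl)
      run)
  ... | r₀ , q , run = lookup (0 ∷ r₀ ∷ []) , refl , q , run

-- The formula stating that a program outputs 1

inputs : {A : Set} → (Fin 4 → A) → Vec A 4
inputs u = u 0F ∷ u 1F ∷ u 2F ∷ u 3F ∷ []

n<2^n : ∀ n → n < 2 ^ n
n<2^n zero    = s≤s z≤n
n<2^n (suc n) = subst (suc (suc n) ≤_) (cong (2 ^ n +_) (sym (+-identityʳ _)))
  (+-mono-≤ (m^n>0 2 n) (n<2^n n))

withOutput : {A : Set} → A → (Fin 4 → A) → Fin 5 → A
withOutput y u fzero    = y
withOutput y u (fsuc i) = u i

module _ (F : PR 4) where

  outputOne : Rel (Fin 5)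
  outputOne = graph F 0F (inputs fsuc)

  -- A single token at position 0, hence the mask 1; its registers are the output 1 and the four
  -- inputs. The base is existentially quantified because it has to exceed every value occurring in
  -- the run.
  outputOneForm : Form (Fin 4)
  outputOneForm = ex (finite-Fin 2)
    ( atom (con 2 ⊕ (K ⊕ K) ≐2^ w)
    and all (finite-Fin 5) (λ i → atom (X i ≺ K ⊕ con 1))
    and parallel (finite-Fin 5) outputOne w K (con 1) X)
    where
    w K : Tm (Fin 4 ⊎ Fin 2)
    w = var (inj₂ 0F)
    K = var (inj₂ 1F)
    X : Fin 5 → Tm (Fin 4 ⊎ Fin 2)
    X = withOutput (con 1) (λ i → var (inj₁ i))

  module _ (u : Fin 4 → ℕ) where
    private
      X : Fin 5 → ℕ
      X = withOutput 1 u

      X-ev : ∀ {ys : Fin 2 → ℕ} i → ev [ u , ys ] (withOutput (con 1) (λ i → var (inj₁ i)) i) ≡ X i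
      X-ev fzero    = refl
      X-ev (fsuc i) = refl

      ≤K⇒<B : ∀ {x} K → x ≤ K → x < Digits.B K
      ≤K⇒<B K l = ≤-<-trans l (m<n⇒m<1+n (s≤s (m≤m+n K K)))

    outputOne-sound : Sat u outputOneForm → Eval F (inputs u) 1
    outputOne-sound (ys , base , small , p) = graph-sound F 0F (inputs fsuc) {X}
      (Sem-cong outputOne (λ i → dig-small-0 (≤K⇒<B K (X≤K i)))
        (parallel-sound (finite-Fin 5) outputOne {X = X} (values refl refl refl X-ev (sym base)) mask supp p 0 dig-1))
      where
      K = ys 1F
      open Digits K
      X≤K : ∀ i → X i ≤ K
      X≤K i = s≤s⁻¹ (subst₂ _<_ (X-ev i) (+-comm K 1) (all-sound (finite-Fin 5) _ small i))
      1<B : 1 < B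
      1<B = s≤s (s≤s z≤n)
      dig-1 : dig 1 0 ≡ 1
      dig-1 = dig-small-0 1<B
      mask : Mask 1
      mask zero    = ≤-reflexive dig-1
      mask (suc t) = subst (_≤ 1) (sym (dig-small-suc 1<B t)) z≤n
      supp : ∀ i t → dig (X i) t ≤ K * dig 1 t
      supp i zero    = subst₂ _≤_ (sym (dig-small-0 (≤K⇒<B K (X≤K i))))
                         (sym (trans (cong (K *_) dig-1) (*-identityʳ K))) (X≤K i)
      supp i (suc t) = subst (_≤ K * dig 1 (suc t)) (sym (dig-small-suc (≤K⇒<B K (X≤K i)) t)) z≤n

    outputOne-complete : Eval F (inputs u) 1 → Sat u outputOneForm
    outputOne-complete p = lookup (suc v ∷ K ∷ []) , sym base ,
      all-complete (finite-Fin 5) _ (λ i → subst₂ _<_ (sym (X-ev i)) (+-comm 1 K) (s≤s (X≤K i))) ,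
      sat {X = X} (values refl refl refl X-ev base) κ≤K
        (represents
          (λ { zero → dig-small-0 {1} (s≤s (s≤s z≤n)) ; (suc t) → dig-small-suc {1} (s≤s (s≤s z≤n)) t })
          (λ { i zero → dig-small-0 (≤K⇒<B K (X≤K i)) ; i (suc t) → dig-small-suc (≤K⇒<B K (X≤K i)) t }))
      where
      m : ℕ → ℕ
      m zero    = 1
      m (suc _) = 0
      x : Fin 5 → ℕ → ℕ
      x i zero    = X i
      x i (suc _) = 0
      only : ParallelComplete (finite-Fin 5) outputOne m x
      only = parallel-complete (finite-Fin 5) outputOne {m} {x} {1}
        (record { m≤1    = λ { zero → ≤-refl ; (suc t) → z≤n }
                ; finite = λ { (suc t) _ → refl }
                ; off    = λ { i (suc t) _ → refl } })
        (λ { zero _ → graph-complete p 0F (inputs fsuc) refl refl })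
      open ParallelComplete only
      M = maxFin 5 X
      -- Since v < 2^v, the number K = 2^v - 1 is at least `v`, so it exceeds neither requirement's
      -- reach: it is above the threshold and above all inputs. The base 2K + 2 is 2^(v+1).
      v = threshold ⊔ proj₁ M
      K = pred (2 ^ v)
      1+K≡ : suc K ≡ 2 ^ v
      1+K≡ = suc-pred (2 ^ v) {{>-nonZero (m^n>0 2 v)}}
      v≤K : v ≤ K
      v≤K = s≤s⁻¹ (subst (v <_) (sym 1+K≡) (n<2^n v))
      κ≤K : threshold ≤ K
      κ≤K = ≤-trans (m≤m⊔n threshold (proj₁ M)) v≤K
      X≤K : ∀ i → X i ≤ K
      X≤K i = ≤-trans (proj₂ M i) (≤-trans (m≤n⊔m threshold (proj₁ M)) v≤K)
      base : 2 ^ suc v ≡ Digits.B K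
      base = trans (cong (2 *_) (sym 1+K≡)) (cong suc (trans (cong (K +_) (+-identityʳ (suc K))) (+-suc K K)))
      open Digits K

-- Linear loops from formulas

-- Opened only here because +_ makes sections such as (m +_) ambiguous.
open import Data.Integer using (+_)

-- A fraction already in lowest terms, so that its numerator, denominator and code compute for a
-- variable `z`; `toℚ` is stuck there on a greatest common divisor.
intℚ : ℤ → ℚ
intℚ z = mkℚ z 0 (Coprime.sym (Coprime.1-coprimeTo ℤ.∣ z ∣))

toℚ≡ : ∀ z → toℚ z ≡ intℚ z
toℚ≡ z = ℚ.↥p/↧p≡p (intℚ z)

intℚ-+ : ∀ a b → intℚ a ℚ.+ intℚ b ≡ intℚ (a ℤ.+ b)
intℚ-+ a b = trans (cong toℚ (cong₂ ℤ._+_ (ℤ.*-identityʳ a) (ℤ.*-identityʳ b))) (toℚ≡ (a ℤ.+ b))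

intℚ-* : ∀ a b → intℚ a ℚ.* intℚ b ≡ intℚ (a ℤ.* b)
intℚ-* a b = toℚ≡ (a ℤ.* b)

intℚ-≤0 : ∀ {a} → intℚ a ℚ.≤ 0ℚ → a ℤ.≤ 0ℤ
intℚ-≤0 {a} (ℚ.*≤* l) = subst (ℤ._≤ 0ℤ) (ℤ.*-identityʳ a) l

≤0-intℚ : ∀ {a} → a ℤ.≤ 0ℤ → intℚ a ℚ.≤ 0ℚ
≤0-intℚ {a} l = ℚ.*≤* (subst (ℤ._≤ 0ℤ) (sym (ℤ.*-identityʳ a)) l)

sumFin-0 : ∀ n (X : Fin n → ℚ) → sumFin n (λ j → 0ℚ ℚ.* X j) ≡ 0ℚ
sumFin-0 zero    X = refl
sumFin-0 (suc n) X = trans (cong₂ ℚ._+_ (ℚ.*-zeroˡ (X fzero)) (sumFin-0 n (X ∘ fsuc))) (ℚ.+-identityˡ 0ℚ)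

diag : ∀ {n} → (Fin n → ℚ) → Matrix n
diag d fzero    fzero    = d fzero
diag d fzero    (fsuc j) = 0ℚ
diag d (fsuc i) fzero    = 0ℚ
diag d (fsuc i) (fsuc j) = diag (d ∘ fsuc) i j

sumFin-diag : ∀ n (d : Fin n → ℚ) (i : Fin n) (X : Fin n → ℚ) → sumFin n (λ j → diag d i j ℚ.* X j) ≡ d i ℚ.* X i
sumFin-diag (suc n) d fzero    X =
  trans (cong (d fzero ℚ.* X fzero ℚ.+_) (sumFin-0 n (X ∘ fsuc))) (ℚ.+-identityʳ _)
sumFin-diag (suc n) d (fsuc i) X =
  trans (cong₂ ℚ._+_ (ℚ.*-zeroˡ (X fzero)) (sumFin-diag n (d ∘ fsuc) i (X ∘ fsuc))) (ℚ.+-identityˡ _)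

-- Coordinates: 0 is halved, 1 is constantly 1, 2 counts the steps, 3 is doubled, the others are constant.
module Dynamics (N : ℕ) where

  scale : Fin (8 + N) → ℚ
  scale 0F = ½
  scale 3F = intℚ (+ 2)
  scale _  = 1ℚ

  A : Matrix (8 + N)
  A 2F 1F = 1ℚ
  A i  j  = diag scale i j

  orbit : ℕ → (Fin (8 + N) → ℤ) → Fin (8 + N) → ℚ
  orbit t X = pow· A t (λ j → toℚ (X j))

  module _ (X : Fin (8 + N) → ℤ) where

    orbit-zero : ∀ i → orbit 0 X i ≡ intℚ (X i)
    orbit-zero i = toℚ≡ (X i)

    orbit-product : ∀ t → orbit t X 0F ℚ.* orbit t X 3F ≡ intℚ (X 0F ℤ.* X 3F)
    orbit-product zero = trans (cong₂ ℚ._*_ (orbit-zero 0F) (orbit-zero 3F)) (intℚ-* (X 0F) (X 3F))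
    orbit-product (suc t) = trans
      (cong₂ ℚ._*_ (sumFin-diag _ scale 0F (orbit t X)) (sumFin-diag _ scale 3F (orbit t X)))
      (trans (half-double (orbit t X 0F) (orbit t X 3F)) (orbit-product t))
      where
      two : ℚ
      two = intℚ (+ 2)
      half-double : ∀ a b → (½ ℚ.* a) ℚ.* (two ℚ.* b) ≡ a ℚ.* b
      half-double a b = begin
        (½ ℚ.* a) ℚ.* (two ℚ.* b)  ≡⟨ cong (ℚ._* (two ℚ.* b)) (ℚ.*-comm ½ a) ⟩
        (a ℚ.* ½) ℚ.* (two ℚ.* b)  ≡⟨ ℚ.*-assoc a ½ (two ℚ.* b) ⟩
        a ℚ.* (½ ℚ.* (two ℚ.* b))  ≡⟨ cong (a ℚ.*_) (ℚ.*-assoc ½ two b) ⟨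
        a ℚ.* (1ℚ ℚ.* b)           ≡⟨ cong (a ℚ.*_) (ℚ.*-identityˡ b) ⟩
        a ℚ.* b                    ∎
        where open ≡-Reasoning

    orbit-one : ∀ t → orbit t X 1F ≡ intℚ (X 1F)
    orbit-one zero    = orbit-zero 1F
    orbit-one (suc t) = trans (sumFin-diag _ scale 1F (orbit t X)) (trans (ℚ.*-identityˡ _) (orbit-one t))

    orbit-const : ∀ t i → orbit t X (4 ↑ʳ i) ≡ intℚ (X (4 ↑ʳ i))
    orbit-const zero    i = orbit-zero (4 ↑ʳ i)
    orbit-const (suc t) i =
      trans (sumFin-diag _ scale (4 ↑ʳ i) (orbit t X)) (trans (ℚ.*-identityˡ _) (orbit-const t i))

    orbit-count : ∀ t → orbit t X 2F ≡ intℚ (X 2F ℤ.+ + t ℤ.* X 1F)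
    orbit-count zero    = trans (orbit-zero 2F) (cong intℚ (sym (ring₀ (X 2F) (X 1F))))
      where
      ring₀ : ∀ c o → c ℤ.+ + 0 ℤ.* o ≡ c
      ring₀ = solveℤ-∀
    orbit-count (suc t) = begin
      0ℚ ℚ.* Y 0F ℚ.+ (1ℚ ℚ.* Y 1F ℚ.+ sumFin _ (λ j → diag (scale ∘ fsuc ∘ fsuc) 0F j ℚ.* Y (fsuc (fsuc j))))
        ≡⟨ cong₂ ℚ._+_ (ℚ.*-zeroˡ (Y 0F)) (cong₂ ℚ._+_ (ℚ.*-identityˡ (Y 1F))
             (trans (sumFin-diag _ (scale ∘ fsuc ∘ fsuc) 0F (Y ∘ fsuc ∘ fsuc)) (ℚ.*-identityˡ (Y 2F)))) ⟩
      0ℚ ℚ.+ (Y 1F ℚ.+ Y 2F)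
        ≡⟨ ℚ.+-identityˡ _ ⟩
      Y 1F ℚ.+ Y 2F
        ≡⟨ cong₂ ℚ._+_ (orbit-one t) (orbit-count t) ⟩
      intℚ (X 1F) ℚ.+ intℚ (X 2F ℤ.+ + t ℤ.* X 1F)
        ≡⟨ intℚ-+ (X 1F) (X 2F ℤ.+ + t ℤ.* X 1F) ⟩
      intℚ (X 1F ℤ.+ (X 2F ℤ.+ + t ℤ.* X 1F))
        ≡⟨ cong intℚ (ring (X 1F) (X 2F) (+ t)) ⟩
      intℚ (X 2F ℤ.+ + suc t ℤ.* X 1F) ∎
      where
      open ≡-Reasoning
      Y = orbit t X
      ring : ∀ o c t → o ℤ.+ (c ℤ.+ t ℤ.* o) ≡ c ℤ.+ (+ 1 ℤ.+ t) ℤ.* o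
      ring = solveℤ-∀

    orbit-power : ∀ t → orbit t X 3F ≡ intℚ (+ (2 ^ t) ℤ.* X 3F)
    orbit-power zero    = trans (orbit-zero 3F) (cong intℚ (sym (ℤ.*-identityˡ (X 3F))))
    orbit-power (suc t) = begin
      orbit (suc t) X 3F                            ≡⟨ sumFin-diag _ scale 3F (orbit t X) ⟩
      intℚ (+ 2) ℚ.* orbit t X 3F                   ≡⟨ cong (intℚ (+ 2) ℚ.*_) (orbit-power t) ⟩
      intℚ (+ 2) ℚ.* intℚ (+ (2 ^ t) ℤ.* X 3F)    ≡⟨ intℚ-* (+ 2) (+ (2 ^ t) ℤ.* X 3F) ⟩
      intℚ (+ 2 ℤ.* (+ (2 ^ t) ℤ.* X 3F))         ≡⟨ cong intℚ (sym (ℤ.*-assoc (+ 2) (+ (2 ^ t)) (X 3F))) ⟩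
      intℚ (+ 2 ℤ.* + (2 ^ t) ℤ.* X 3F)           ≡⟨ cong (λ z → intℚ (z ℤ.* X 3F)) (sym (ℤ.pos-* 2 (2 ^ t))) ⟩
      intℚ (+ (2 ^ suc t) ℤ.* X 3F)               ∎
      where open ≡-Reasoning

-- Comparisons of natural numbers as polynomial guards

toPoly : {V : Set} {n : ℕ} → (V → Fin n) → Tm V → Poly n
toPoly ρ (con k) = con (intℚ (+ k))
toPoly ρ (var x) = var (ρ x)
toPoly ρ (s ⊕ t) = add (toPoly ρ s) (toPoly ρ t)
toPoly ρ (s ⊗ t) = mul (toPoly ρ s) (toPoly ρ t)

module _ {V : Set} {n : ℕ} (ρ : V → Fin n) {Y : Fin n → ℚ} {σ : V → ℕ} (h : ∀ x → Y (ρ x) ≡ intℚ (+ σ x)) where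

  eval-toPoly : ∀ t → evalPoly (toPoly ρ t) Y ≡ intℚ (+ ev σ t)
  eval-toPoly (con k) = refl
  eval-toPoly (var x) = h x
  eval-toPoly (s ⊕ t) = trans (cong₂ ℚ._+_ (eval-toPoly s) (eval-toPoly t)) (intℚ-+ (+ ev σ s) (+ ev σ t))
  eval-toPoly (s ⊗ t) = trans (cong₂ ℚ._*_ (eval-toPoly s) (eval-toPoly t))
    (trans (intℚ-* (+ ev σ s) (+ ev σ t)) (cong intℚ (sym (ℤ.pos-* (ev σ s) (ev σ t)))))

minus : ∀ {n} → Poly n → Poly n
minus p = mul (con (intℚ -[1+ 0 ])) p

infix 4 _⊏_
record Comparison (V : Set) : Set where
  constructor _⊏_
  field
    lhs rhs : Tm V

module _ {V : Set} where

  difference : {n : ℕ} → (V → Fin n) → Comparison V → Poly n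
  difference ρ (s ⊏ t) = add (toPoly ρ t) (minus (toPoly ρ s))

  IsTrue : (V → ℕ) → Comparison V → Set
  IsTrue σ (s ⊏ t) = ev σ s < ev σ t

  module _ {n : ℕ} (ρ : V → Fin n) {Y : Fin n → ℚ} {σ : V → ℕ} (h : ∀ x → Y (ρ x) ≡ intℚ (+ σ x)) where

    eval-difference : ∀ s t → evalPoly (difference ρ (s ⊏ t)) Y ≡ intℚ (+ ev σ t ℤ.+ -[1+ 0 ] ℤ.* + ev σ s)
    eval-difference s t = trans
      (cong₂ ℚ._+_ (eval-toPoly ρ h t) (trans (cong (intℚ -[1+ 0 ] ℚ.*_) (eval-toPoly ρ h s)) (intℚ-* -[1+ 0 ] (+ ev σ s))))
      (intℚ-+ (+ ev σ t) (-[1+ 0 ] ℤ.* + ev σ s))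

    sub≡ : ∀ a b → a ℤ.+ -[1+ 0 ] ℤ.* b ≡ a ℤ.- b
    sub≡ = solveℤ-∀

    difference-sound : ∀ c → ¬ (evalPoly (difference ρ c) Y ℚ.≤ 0ℚ) → IsTrue σ c
    difference-sound (s ⊏ t) ¬≤ = ≰⇒> λ t≤s → ¬≤ (subst (ℚ._≤ 0ℚ) (sym (eval-difference s t))
      (≤0-intℚ (subst (ℤ._≤ 0ℤ) (sym (sub≡ (+ ev σ t) (+ ev σ s))) (ℤ.i≤j⇒i-j≤0 (ℤ.+≤+ t≤s)))))

    difference-complete : ∀ c → IsTrue σ c → ¬ (evalPoly (difference ρ c) Y ℚ.≤ 0ℚ)
    difference-complete (s ⊏ t) s<t ≤0 = <⇒≱ s<t (ℤ.drop‿+≤+ (ℤ.i-j≤0⇒i≤j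
      (subst (ℤ._≤ 0ℤ) (sub≡ (+ ev σ t) (+ ev σ s)) (intℚ-≤0 (subst (ℚ._≤ 0ℚ) (eval-difference s t) ≤0)))))

-- This is (a - b)² < 1 without subtraction; lowering both numbers by 1 keeps the difference.
squares-sound : ∀ a b → a * a + b * b < 1 + (a * b + a * b) → a ≡ b
squares-sound zero    zero    _ = refl
squares-sound zero    (suc b) (s≤s ())
squares-sound (suc a) zero    l = ⊥-elim (<⇒≱ l (subst (λ z → 1 + (z + z) ≤ suc a * suc a + 0)
  (sym (*-zeroʳ a)) (s≤s z≤n)))
squares-sound (suc a) (suc b) l = cong suc (squares-sound a b
  (+-cancelʳ-< (2 + (a + a) + (b + b)) _ _ (subst₂ _<_ (lhs a b) (rhs a b) l)))
  where
  lhs : ∀ a b → suc a * suc a + suc b * suc b ≡ (a * a + b * b) + (2 + (a + a) + (b + b))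
  lhs = solve-∀
  rhs : ∀ a b → 1 + (suc a * suc b + suc a * suc b) ≡ (1 + (a * b + a * b)) + (2 + (a + a) + (b + b))
  rhs = solve-∀

squares-complete : ∀ {a b} → a ≡ b → a * a + b * b < 1 + (a * b + a * b)
squares-complete refl = n<1+n _

equation : {V : Set} → Tm V → Tm V → Comparison V
equation s t = s ⊗ s ⊕ t ⊗ t ⊏ con 1 ⊕ (s ⊗ t ⊕ s ⊗ t)

-- 1 + (c - a)²(b² + p²) - (b - p)² > 0 with the negative terms moved to the left: if c = a this
-- says b = p, and otherwise it holds.
equationIf : {V : Set} → (c a b p : Tm V) → Comparison V
equationIf c a b p = (c ⊗ a ⊕ c ⊗ a) ⊗ q ⊕ q ⊏ con 1 ⊕ ((c ⊗ c ⊕ a ⊗ a) ⊗ q ⊕ (b ⊗ p ⊕ b ⊗ p))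
  where q = b ⊗ b ⊕ p ⊗ p

equationIf-sound : {V : Set} {σ : V → ℕ} (c a b p : Tm V) → IsTrue σ (equationIf c a b p) →
  ev σ c ≡ ev σ a → ev σ b ≡ ev σ p
equationIf-sound {σ = σ} c a b p l c≡a rewrite c≡a = squares-sound (ev σ b) (ev σ p)
  (+-cancelˡ-< r _ _ (subst (r + q <_) (sym (+-suc r _)) l))
  where
  q = ev σ b * ev σ b + ev σ p * ev σ p
  r = (ev σ a * ev σ a + ev σ a * ev σ a) * q

equationIf-complete : {V : Set} {σ : V → ℕ} (c a b p : Tm V) →
  (ev σ c ≡ ev σ a → ev σ b ≡ ev σ p) → IsTrue σ (equationIf c a b p)
equationIf-complete {σ = σ} c a b p h with ev σ c | ev σ a | ev σ b | ev σ p | ev σ c ≟ ev σ a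
... | x | y | u | v | yes refl = subst ((x * x + x * x) * (u * u + v * v) + (u * u + v * v) <_) (+-suc _ _)
  (+-monoʳ-< ((x * x + x * x) * (u * u + v * v)) (squares-complete (h refl)))
... | x | y | u | v | no x≢y = s≤s (≤-trans
  (≤-trans (≤-reflexive (+-comm ((x * y + x * y) * q) q))
    (*-monoˡ-≤ q (≮⇒≥ λ l → x≢y (squares-sound x y l))))
  (m≤m+n _ (u * v + u * v)))
  where q = u * u + v * v

-- The loop of a system of atoms

module Reduction (N : ℕ) (atoms : List (Atom (Fin (4 + N)))) where

  open Dynamics N

  Input : Set
  Input = Fin (8 + N) → ℤ

  -- `time` is the moment at which the guard is tested on an input. Passing every guard at its own
  -- moment makes the input code a solution.
  record Guard : Set where
    constructor guard
    field
      poly : Poly (8 + N)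
      time : Input → ℕ
  open Guard

  Positive : Input → ℕ → Guard → Set
  Positive X t g = ¬ (evalPoly (poly g) (orbit t X) ℚ.≤ 0ℚ)

  lift : Tm (Fin (4 + N)) → Tm (Fin (7 + N))
  lift = mapTm (3 ↑ʳ_)

  comparison : Atom (Fin (4 + N)) → Comparison (Fin (7 + N))
  comparison (s ≐ t)   = equation (lift s) (lift t)
  comparison (s ≺ t)   = lift s ⊏ lift t
  comparison (s ≐2^ t) = equationIf (var 1F) (lift t) (lift s) (var 2F)

  -- The guard of s = 2^t is a real restriction only when the step counter equals the value of `t`.
  -- The other guards express their atoms at every moment, and 0 is taken.
  critical : Atom (Fin (4 + N)) → (Fin (4 + N) → ℕ) → ℕ
  critical (s ≐ t)   τ = 0
  critical (s ≺ t)   τ = 0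
  critical (s ≐2^ t) τ = ev τ t

  -- The values at time t of the coordinates 1, 2, …
  valuesAt : ℕ → (Fin (4 + N) → ℕ) → Fin (7 + N) → ℕ
  valuesAt t τ 0F                     = 1
  valuesAt t τ 1F                     = t
  valuesAt t τ 2F                     = 2 ^ t
  valuesAt t τ (fsuc (fsuc (fsuc i))) = τ i

  ev-lift : ∀ t τ s → ev (valuesAt t τ) (lift s) ≡ ev τ s
  ev-lift t τ = ev-map (3 ↑ʳ_) (λ _ → refl)

  comparison-sound : ∀ τ a → IsTrue (valuesAt (critical a τ) τ) (comparison a) → Holds τ a
  comparison-sound τ (s ≐ t) p = subst₂ _≡_ (ev-lift 0 τ s) (ev-lift 0 τ t) (squares-sound _ _ p)
  comparison-sound τ (s ≺ t) p = subst₂ _<_ (ev-lift 0 τ s) (ev-lift 0 τ t) p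
  comparison-sound τ (s ≐2^ t) p = trans (sym (ev-lift k τ s))
    (equationIf-sound {σ = valuesAt k τ} (var 1F) (lift t) (lift s) (var 2F) p (sym (ev-lift k τ t)))
    where k = ev τ t

  comparison-complete : ∀ k τ a → Holds τ a → IsTrue (valuesAt k τ) (comparison a)
  comparison-complete k τ (s ≐ t) p = squares-complete (trans (ev-lift k τ s) (trans p (sym (ev-lift k τ t))))
  comparison-complete k τ (s ≺ t) p = subst₂ _<_ (sym (ev-lift k τ s)) (sym (ev-lift k τ t)) p
  comparison-complete k τ (s ≐2^ t) p = equationIf-complete {σ = valuesAt k τ} (var 1F) (lift t) (lift s) (var 2F)
    λ k≡ → trans (ev-lift k τ s) (trans p (cong (2 ^_) (sym (trans k≡ (ev-lift k τ t)))))

  always : Poly (8 + N) → Guard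
  always p = guard p λ _ → 0

  atomGuard : Atom (Fin (4 + N)) → Guard
  atomGuard a = guard (difference fsuc (comparison a)) λ X → critical a λ i → ℤ.∣ X (4 ↑ʳ i) ∣

  nonNegative : Fin (7 + N) → Guard
  nonNegative v = always (add (var (fsuc v)) (con (intℚ (+ 1))))

  product : Poly (8 + N)
  product = mul (var 0F) (var 3F)

  parameterGuard : Fin 4 → ℕ → Guard
  parameterGuard i v = always (difference fsuc (equation (var (3 ↑ʳ (i ↑ˡ N))) (con v)))

  -- The product of coordinates 0 and 3 is invariant; being 1 initially, with integer factors, it makes
  -- coordinate 3 start at 1, and coordinate 2, being natural and smaller, start at 0.
  guards : List Guard
  guards = always product
         ∷ always (add (con (intℚ (+ 2))) (minus product))
         ∷ always (difference fsuc (equation (var 0F) (con 1)))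
         ∷ always (difference fsuc (var 1F ⊏ var 2F))
         ∷ List.map nonNegative (List.allFin (7 + N)) ++ List.map atomGuard atoms

  -- The guards that mention `u` come first, so that in the code of the list the remaining guards
  -- form a tail independent of `u`.
  allGuards : (Fin 4 → ℕ) → List Guard
  allGuards u = parameterGuard 0F (u 0F) ∷ parameterGuard 1F (u 1F) ∷
                parameterGuard 2F (u 2F) ∷ parameterGuard 3F (u 3F) ∷ guards

  loopFor : (Fin 4 → ℕ) → Instance
  -- An instance has `suc k` guards, hence 3 for the four parameter guards.
  loopFor u = inst (7 + N) (3 + List.length guards) A (λ i → poly (List.lookup (allGuards u) i))

  Solution : (Fin 4 → ℕ) → Set
  Solution u = Σ (Fin (4 + N) → ℕ) λ τ → (∀ i → τ (i ↑ˡ N) ≡ u i) × All (Holds τ) atoms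

  orbit-values : ∀ X (τ : Fin (4 + N) → ℕ) → X 1F ≡ + 1 → X 2F ≡ + 0 → X 3F ≡ + 1 → (∀ i → X (4 ↑ʳ i) ≡ + τ i) →
    ∀ t v → orbit t X (fsuc v) ≡ intℚ (+ valuesAt t τ v)
  orbit-values X τ o c p h t 0F = trans (orbit-one X t) (cong intℚ o)
  orbit-values X τ o c p h t 1F = trans (orbit-count X t) (cong intℚ
    (trans (cong₂ (λ x y → x ℤ.+ + t ℤ.* y) c o) (trans (ℤ.+-identityˡ _) (ℤ.*-identityʳ (+ t)))))
  orbit-values X τ o c p h t 2F = trans (orbit-power X t) (cong intℚ (trans (cong (+ (2 ^ t) ℤ.*_) p) (ℤ.*-identityʳ _)))
  orbit-values X τ o c p h t (fsuc (fsuc (fsuc i))) = trans (orbit-const X t i) (cong intℚ (h i))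

  unit : ∀ z → ¬ (z ℤ.≤ 0ℤ) → ¬ (+ 2 ℤ.+ -[1+ 0 ] ℤ.* z ℤ.≤ 0ℤ) → z ≡ + 1
  unit -[1+ k ]          p q = ⊥-elim (p ℤ.-≤+)
  unit (+ 0)             p q = ⊥-elim (p (ℤ.+≤+ z≤n))
  unit (+ 1)             p q = refl
  unit (+ suc (suc k))   p q = ⊥-elim (q (subst (ℤ._≤ 0ℤ)
    (cong (λ z → + 2 ℤ.+ z) (sym (ℤ.-1*i≡-i (+ (2 + k))))) (ℤ.i≤j⇒i-j≤0 {+ 2} {+ (2 + k)} (ℤ.+≤+ (s≤s (s≤s z≤n))))))

  natural : ∀ z → ¬ (toℚ z ℚ.+ intℚ (+ 1) ℚ.≤ 0ℚ) → z ≡ + ℤ.∣ z ∣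
  natural (+ k)    p = refl
  natural -[1+ k ] p = ⊥-elim (p (subst (ℚ._≤ 0ℚ)
    (sym (trans (cong (ℚ._+ intℚ (+ 1)) (toℚ≡ -[1+ k ])) (intℚ-+ -[1+ k ] (+ 1))))
    (≤0-intℚ (1-suc≤0 k))))
    where
    1-suc≤0 : ∀ k → -[1+ k ] ℤ.+ + 1 ℤ.≤ 0ℤ
    1-suc≤0 zero    = ℤ.+≤+ z≤n
    1-suc≤0 (suc k) = ℤ.-≤+

  lookupAll : {P : Guard → Set} (gs : List Guard) → (∀ i → P (List.lookup gs i)) → All P gs
  lookupAll []       h = []
  lookupAll (g ∷ gs) h = h fzero ∷ lookupAll gs (h ∘ fsuc)

  -- Termination requires an explicit moment, which a finite search supplies: a guard failing at its
  -- test moment halts the loop there. If all pass, the constant coordinates form a solution.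
  solve-or-terminate : ∀ u X → TerminatesOn (loopFor u) X ⊎ Solution u
  solve-or-terminate u X
    with any? (λ i → let g = List.lookup (allGuards u) i in evalPoly (poly g) (orbit (time g X) X) ℚ.≤? 0ℚ)
  ... | yes (i , p) = inj₁ (time (List.lookup (allGuards u) i) X , i , p)
  ... | no ¬p = inj₂ (τ , params , atoms-hold)
    where
    τ : Fin (4 + N) → ℕ
    τ i = ℤ.∣ X (4 ↑ʳ i) ∣
    passed : All (λ g → Positive X (time g X) g) (allGuards u)
    passed = lookupAll (allGuards u) λ i q → ¬p (i , q)
    base : All (λ g → Positive X (time g X) g) guards
    base = All.drop⁺ 4 passed
    rest = All.drop⁺ 4 base
    natural-X : ∀ v → X (fsuc v) ≡ + ℤ.∣ X (fsuc v) ∣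
    natural-X v = natural (X (fsuc v))
      (All.lookup (All.map⁻ (All.++⁻ˡ (List.map nonNegative (List.allFin (7 + N))) rest)) (∈-allFin v))
    x : Fin (7 + N) → ℕ
    x v = ℤ.∣ X (fsuc v) ∣
    orbit-x : ∀ v → orbit 0 X (fsuc v) ≡ intℚ (+ x v)
    orbit-x v = trans (orbit-zero X (fsuc v)) (cong intℚ (natural-X v))
    wp : ℤ
    wp = X 0F ℤ.* X 3F
    wp≡1 : wp ≡ + 1
    wp≡1 with base
    ... | p₁ ∷ p₂ ∷ _ = unit wp
      (λ l → p₁ (subst (ℚ._≤ 0ℚ) (sym (orbit-product X 0)) (≤0-intℚ l)))
      (λ l → p₂ (subst (ℚ._≤ 0ℚ) (sym (trans
        (cong (λ z → intℚ (+ 2) ℚ.+ intℚ -[1+ 0 ] ℚ.* z) (orbit-product X 0))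
        (trans (cong (intℚ (+ 2) ℚ.+_) (intℚ-* -[1+ 0 ] wp)) (intℚ-+ (+ 2) (-[1+ 0 ] ℤ.* wp)))))
        (≤0-intℚ l)))
    -- Integrality enters here: an integer factor of 1 has absolute value 1, and its sign is settled
    -- by `natural-X`.
    p≡1 : x 2F ≡ 1
    p≡1 = m*n≡1⇒n≡1 ℤ.∣ X 0F ∣ (x 2F) (trans (sym (ℤ.abs-* (X 0F) (X 3F))) (cong ℤ.∣_∣ wp≡1))
    o≡1 : x 0F ≡ 1
    o≡1 with base
    ... | _ ∷ _ ∷ p ∷ _ = squares-sound (x 0F) 1
      (difference-sound fsuc {Y = orbit 0 X} {σ = x} orbit-x (equation (var 0F) (con 1)) p)
    c≡0 : x 1F ≡ 0
    c≡0 with base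
    ... | _ ∷ _ ∷ _ ∷ p ∷ _ =
      n<1⇒n≡0 (subst (x 1F <_) p≡1 (difference-sound fsuc {Y = orbit 0 X} {σ = x} orbit-x (var 1F ⊏ var 2F) p))
    orbit-τ : ∀ t v → orbit t X (fsuc v) ≡ intℚ (+ valuesAt t τ v)
    orbit-τ = orbit-values X τ (trans (natural-X 0F) (cong +_ o≡1)) (trans (natural-X 1F) (cong +_ c≡0))
      (trans (natural-X 2F) (cong +_ p≡1)) (λ i → natural-X (3 ↑ʳ i))
    params : ∀ i → τ (i ↑ˡ N) ≡ u i
    params i = squares-sound _ _ (difference-sound fsuc {Y = orbit 0 X} {σ = x} orbit-x
      (equation (var (3 ↑ʳ (i ↑ˡ N))) (con (u i))) (param i passed))
      where
      param : ∀ i → All (λ g → Positive X (time g X) g) (allGuards u) → Positive X 0 (parameterGuard i (u i))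
      param 0F (p ∷ _) = p
      param 1F (_ ∷ p ∷ _) = p
      param 2F (_ ∷ _ ∷ p ∷ _) = p
      param 3F (_ ∷ _ ∷ _ ∷ p ∷ _) = p
    atoms-hold : All (Holds τ) atoms
    atoms-hold = All.map
      (λ {a} p → comparison-sound τ a
        (difference-sound fsuc {σ = valuesAt (critical a τ) τ} (orbit-τ (critical a τ)) (comparison a) p))
      (All.map⁻ (All.++⁻ʳ (List.map nonNegative (List.allFin (7 + N))) rest))

  module _ {u : Fin 4 → ℕ} (τ : Fin (4 + N) → ℕ) (params : ∀ i → τ (i ↑ˡ N) ≡ u i) (holds : All (Holds τ) atoms) where

    solutionInput : Input
    solutionInput 0F = + 1
    solutionInput 1F = + 1
    solutionInput 2F = + 0
    solutionInput 3F = + 1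
    solutionInput (fsuc (fsuc (fsuc (fsuc i)))) = + τ i

    private
      X = solutionInput

      product≡1 : ∀ t → evalPoly product (orbit t X) ≡ intℚ (+ 1)
      product≡1 = orbit-product X

      orbit-τ : ∀ t v → orbit t X (fsuc v) ≡ intℚ (+ valuesAt t τ v)
      orbit-τ = orbit-values X τ refl refl refl (λ _ → refl)

      istrue : ∀ t c → IsTrue (valuesAt t τ) c → Positive X t (always (difference fsuc c))
      istrue t = difference-complete fsuc (orbit-τ t)

      parameter : ∀ t i → Positive X t (parameterGuard i (u i))
      parameter t i = istrue t (equation (var (3 ↑ʳ (i ↑ˡ N))) (con (u i))) (squares-complete (params i))

      ¬1≤0 : ¬ (intℚ (+ 1) ℚ.≤ 0ℚ)
      ¬1≤0 l with intℚ-≤0 l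
      ... | ℤ.+≤+ ()

      nonNegative-holds : ∀ t v → Positive X t (nonNegative v)
      nonNegative-holds t v l with intℚ-≤0 (subst (ℚ._≤ 0ℚ)
        (trans (cong (ℚ._+ intℚ (+ 1)) (orbit-τ t v)) (trans (intℚ-+ (+ valuesAt t τ v) (+ 1))
          (cong (λ z → intℚ (+ z)) (+-comm (valuesAt t τ v) 1)))) l)
      ... | ℤ.+≤+ ()

    guards-hold : ∀ t → All (Positive X t) (allGuards u)
    guards-hold t = parameter t 0F ∷ parameter t 1F ∷ parameter t 2F ∷ parameter t 3F
      ∷ (λ l → ¬1≤0 (subst (ℚ._≤ 0ℚ) (product≡1 t) l))
      ∷ (λ l → ¬1≤0 (subst (ℚ._≤ 0ℚ) (cong (λ z → intℚ (+ 2) ℚ.+ intℚ -[1+ 0 ] ℚ.* z) (product≡1 t)) l))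
      ∷ istrue t (equation (var 0F) (con 1)) (squares-complete {1} refl)
      ∷ istrue t (var 1F ⊏ var 2F) (n<2^n t)
      ∷ All.++⁺ (All.map⁺ (All.tabulate λ {v} _ → nonNegative-holds t v))
                (All.map⁺ (All.map (λ {a} h → istrue t (comparison a) (comparison-complete t τ a h)) holds))

    solution-nonterminating : ¬ TerminatingOverℤ (loopFor u)
    solution-nonterminating terminates with terminates solutionInput
    ... | t , i , l = lookupPos (allGuards u) (guards-hold t) i l
      where
      lookupPos : (gs : List Guard) → All (Positive X t) gs → ∀ i → Positive X t (List.lookup gs i)
      lookupPos (g ∷ gs) (p ∷ ps) fzero    = p
      lookupPos (g ∷ gs) (p ∷ ps) (fsuc i) = lookupPos gs ps i

-- Diagonalisation

mutual
  Eval-deterministic : ∀ {a} {f : PR a} {xs y z} → Eval f xs y → Eval f xs z → y ≡ z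
  Eval-deterministic eZ eZ = refl
  Eval-deterministic (eS x) (eS .x) = refl
  Eval-deterministic (eproj i xs) (eproj .i .xs) = refl
  Eval-deterministic (ecomp ps p) (ecomp qs q) with EvalV-deterministic ps qs
  ... | refl = Eval-deterministic p q
  Eval-deterministic (eprec0 p) (eprec0 q) = Eval-deterministic p q
  Eval-deterministic (eprecS p p′) (eprecS q q′) with Eval-deterministic p q
  ... | refl = Eval-deterministic p′ q′
  Eval-deterministic (emu {y = y} p ps) (emu {y = z} q qs) with <-cmp y z
  ... | tri≈ _ y≡z _ = y≡z
  ... | tri< y<z _ _ with Eval-deterministic p (proj₂ (qs y y<z))
  ... | ()
  Eval-deterministic (emu {y = y} p ps) (emu {y = z} q qs) | tri> _ _ z<y with Eval-deterministic q (proj₂ (ps z z<y))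
  ... | ()

  EvalV-deterministic : ∀ {a b} {gs : Vec (PR a) b} {xs ys zs} → EvalV gs xs ys → EvalV gs xs zs → ys ≡ zs
  EvalV-deterministic []       []       = refl
  EvalV-deterministic (p ∷ ps) (q ∷ qs) = cong₂ _∷_ (Eval-deterministic p q) (EvalV-deterministic ps qs)

-- Computing the code of a loop by a recursive function

natPR : ∀ {a} → ℕ → PR a
natPR zero    = comp Z []
natPR (suc k) = comp S (natPR k ∷ [])

natPR-eval : ∀ {a} k (xs : Vec ℕ a) → Eval (natPR k) xs k
natPR-eval zero    xs = ecomp [] eZ
natPR-eval (suc k) xs = ecomp (natPR-eval k xs ∷ []) (eS k)

addPR : PR 2
addPR = prec (proj 0F) (comp S (proj 1F ∷ []))

addPR-eval : ∀ x y → Eval addPR (x ∷ y ∷ []) (x + y)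
addPR-eval zero    y = eprec0 (eproj 0F (y ∷ []))
addPR-eval (suc x) y = eprecS (addPR-eval x y) (ecomp (eproj 1F _ ∷ []) (eS (x + y)))

triPR : PR 1
triPR = prec Z (comp addPR (comp S (proj 0F ∷ []) ∷ proj 1F ∷ []))

triPR-eval : ∀ x → Eval triPR (x ∷ []) (tri x)
triPR-eval zero    = eprec0 eZ
triPR-eval (suc x) = eprecS (triPR-eval x)
  (ecomp (ecomp (eproj 0F _ ∷ []) (eS x) ∷ eproj 1F _ ∷ []) (addPR-eval (suc x) (tri x)))

pairPR : PR 2
pairPR = comp addPR (comp triPR (addPR ∷ []) ∷ proj 1F ∷ [])

pairPR-eval : ∀ x y → Eval pairPR (x ∷ y ∷ []) (pair x y)
pairPR-eval x y = ecomp (ecomp (addPR-eval x y ∷ []) (triPR-eval (x + y)) ∷ eproj 1F _ ∷ [])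
  (addPR-eval (tri (x + y)) y)

doublePR : PR 1
doublePR = prec Z (comp S (comp S (proj 1F ∷ []) ∷ []))

doublePR-eval : ∀ x → Eval doublePR (x ∷ []) (x * 2)
doublePR-eval zero    = eprec0 eZ
doublePR-eval (suc x) = eprecS (doublePR-eval x) (ecomp (ecomp (eproj 1F _ ∷ []) (eS _) ∷ []) (eS _))

data Expr : Set where
  nat    : ℕ → Expr
  input  : Fin 4 → Expr
  double : Expr → Expr
  ⟨_,_⟩  : Expr → Expr → Expr
  1+     : Expr → Expr

value : (Fin 4 → ℕ) → Expr → ℕ
value u (nat k)    = k
value u (input i)  = u i
value u (double e) = value u e * 2
value u ⟨ d , e ⟩  = pair (value u d) (value u e)
value u (1+ e)     = suc (value u e)

compile : Expr → PR 4
compile (nat k)    = natPR k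
compile (input i)  = proj i
compile (double e) = comp doublePR (compile e ∷ [])
compile ⟨ d , e ⟩  = comp pairPR (compile d ∷ compile e ∷ [])
compile (1+ e)     = comp S (compile e ∷ [])

compile-eval : ∀ u e → Eval (compile e) (inputs u) (value u e)
compile-eval u (nat k)    = natPR-eval k (inputs u)
compile-eval u (input 0F) = eproj 0F (inputs u)
compile-eval u (input 1F) = eproj 1F (inputs u)
compile-eval u (input 2F) = eproj 2F (inputs u)
compile-eval u (input 3F) = eproj 3F (inputs u)
compile-eval u (double e) = ecomp (compile-eval u e ∷ []) (doublePR-eval (value u e))
compile-eval u ⟨ d , e ⟩  =
  ecomp (compile-eval u d ∷ compile-eval u e ∷ []) (pairPR-eval (value u d) (value u e))
compile-eval u (1+ e)     = ecomp (compile-eval u e ∷ []) (eS (value u e))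

-- A polynomial over the first eight coordinates in which hole stands for a natural constant.
data Template : Set where
  hole    : Template
  con     : ℚ → Template
  var     : Fin 8 → Template
  add mul : Template → Template → Template

fill : ∀ {N} → ℕ → Template → Poly (8 + N)
fill v hole      = con (intℚ (+ v))
fill v (con q)   = con q
fill v (var i)   = var (i ↑ˡ _)
fill v (add p q) = add (fill v p) (fill v q)
fill v (mul p q) = mul (fill v p) (fill v q)

templateCode : Fin 4 → Template → Expr
-- The integer `+ v` has the code `v * 2`, and the denominator 1 is stored as 0.
templateCode j hole      = ⟨ nat 0 , ⟨ double (input j) , nat 0 ⟩ ⟩
templateCode j (con q)   = ⟨ nat 0 , nat (encℚ q) ⟩
templateCode j (var i)   = ⟨ nat 1 , nat (toℕ i) ⟩
templateCode j (add p q) = ⟨ nat 2 , ⟨ templateCode j p , templateCode j q ⟩ ⟩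
templateCode j (mul p q) = ⟨ nat 3 , ⟨ templateCode j p , templateCode j q ⟩ ⟩

templateCode-value : ∀ {N} u j p → value u (templateCode j p) ≡ encPoly (fill {N} (u j) p)
templateCode-value u j hole      = refl
templateCode-value u j (con q)   = refl
templateCode-value {N} u j (var i) = cong (pair 1) (sym (toℕ-↑ˡ i N))
templateCode-value u j (add p q) =
  cong₂ (λ x y → pair 2 (pair x y)) (templateCode-value u j p) (templateCode-value u j q)
templateCode-value u j (mul p q) =
  cong₂ (λ x y → pair 3 (pair x y)) (templateCode-value u j p) (templateCode-value u j q)

-- The polynomial of `parameterGuard` written out: 1 + 2xv - (x² + v²), with the hole in place of
-- `v`.
parameterTemplate : Fin 4 → Template
parameterTemplate i = add (add (con (intℚ (+ 1))) (add (mul x hole) (mul x hole)))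
                          (mul (con (intℚ -[1+ 0 ])) (add (mul x x) (mul hole hole)))
  where
  x : Template
  x = var (4 ↑ʳ i)

-- The code of loopFor u is computed from four numbers: two sizes, the code of the matrix and that of the
-- guards not mentioning u. The codes of the other guards are arguments: unfolding pair on concrete numbers
-- is infeasible.
instanceCode : (Fin 4 → Expr) → Expr
instanceCode e = ⟨ input 0F , ⟨ input 1F , ⟨ input 2F ,
  1+ ⟨ e 0F , 1+ ⟨ e 1F , 1+ ⟨ e 2F , 1+ ⟨ e 3F , input 3F ⟩ ⟩ ⟩ ⟩ ⟩ ⟩ ⟩

assemble : ℕ → ℕ → ℕ → (Fin 4 → ℕ) → ℕ → ℕ
assemble n k a g s = pair n (pair k (pair a
  (suc (pair (g 0F) (suc (pair (g 1F) (suc (pair (g 2F) (suc (pair (g 3F) s))))))))))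

assemble-cong : ∀ n k a {g g′} s → (∀ i → g i ≡ g′ i) → assemble n k a g s ≡ assemble n k a g′ s
assemble-cong n k a s h = cong (λ z → pair n (pair k (pair a z)))
  (cons (h 0F) (cons (h 1F) (cons (h 2F) (cons (h 3F) refl))))
  where
  cons : ∀ {x y s t} → x ≡ y → s ≡ t → suc (pair x s) ≡ suc (pair y t)
  cons = cong₂ (λ x s → suc (pair x s))

opaque
  matrixCode : ∀ n → Matrix (suc n) → ℕ
  matrixCode n A = encFun (suc n) (λ i → encFun (suc n) (λ j → encℚ (A i j)))

  guardsCode : ∀ {n} {G : Set} → (G → Poly n) → List G → ℕ
  guardsCode poly gs = encFun (List.length gs) (λ i → encPoly (poly (List.lookup gs i)))

  encInstance-assemble : ∀ n A {G : Set} (poly : G → Poly (suc n)) (g : Fin 4 → G) (gs : List G) →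
    encInstance (inst n (3 + List.length gs) A (λ i → poly (List.lookup (g 0F ∷ g 1F ∷ g 2F ∷ g 3F ∷ gs) i))) ≡
    assemble n (3 + List.length gs) (matrixCode n A) (λ i → encPoly (poly (g i))) (guardsCode poly gs)
  encInstance-assemble n A poly g gs = refl

-- Stated for arbitrary guards and with equations as hypotheses, so that sizes and codes remain
-- variables throughout the proof.
instanceCode-correct : ∀ n A {G : Set} (poly : G → Poly (suc n)) (g : Fin 4 → G) (gs : List G)
  {I : Instance} (u : Fin 4 → ℕ) (e : Fin 4 → Expr) →
  inst n (3 + List.length gs) A (λ i → poly (List.lookup (g 0F ∷ g 1F ∷ g 2F ∷ g 3F ∷ gs) i)) ≡ I →
  n ≡ u 0F → 3 + List.length gs ≡ u 1F → matrixCode n A ≡ u 2F → guardsCode poly gs ≡ u 3F →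
  (∀ i {p} → poly (g i) ≡ p → value u (e i) ≡ encPoly p) →
  value u (instanceCode e) ≡ encInstance I
instanceCode-correct n A poly g gs u e refl n≡ k≡ a≡ s≡ h = sym (trans (encInstance-assemble n A poly g gs)
  (trans (assemble-cong n (3 + List.length gs) (matrixCode n A) (guardsCode poly gs) (λ i → sym (h i refl)))
    (rewrite-all n≡ k≡ a≡ s≡)))
  where
  rewrite-all : ∀ {n k a s} → n ≡ u 0F → k ≡ u 1F → a ≡ u 2F → s ≡ u 3F →
    assemble n k a (λ i → value u (e i)) s ≡ value u (instanceCode e)
  rewrite-all refl refl refl refl = refl

parameterCode : Fin 4 → Expr
parameterCode i = templateCode i (parameterTemplate i)

module FormLoop (φ : Form (Fin 4)) where

  N : ℕ
  N = boundVars φ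

  atoms : List (Atom (Fin (4 + N)))
  atoms = flatten φ (_↑ˡ N) (4 ↑ʳ_)

  open Reduction N atoms public

  sat⇒nonterminating : ∀ u → Sat u φ → ¬ TerminatingOverℤ (loopFor u)
  sat⇒nonterminating u p with flatten-complete φ p
  ... | bs , h = solution-nonterminating τ params (h (_↑ˡ N) (4 ↑ʳ_) params bounds)
    where
    τ : Fin (4 + N) → ℕ
    τ = [ u , bs ] ∘ splitAt 4
    params : ∀ i → τ (i ↑ˡ N) ≡ u i
    params i = cong [ u , bs ] (splitAt-↑ˡ 4 i N)
    bounds : ∀ i → τ (4 ↑ʳ i) ≡ bs i
    bounds i = cong [ u , bs ] (splitAt-↑ʳ 4 N i)

  unsat⇒terminating : ∀ u → ¬ Sat u φ → TerminatingOverℤ (loopFor u)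
  unsat⇒terminating u ¬p X with solve-or-terminate u X
  ... | inj₁ t = t
  ... | inj₂ (τ , params , holds) = ⊥-elim (¬p
    (flatten-sound φ (_↑ˡ N) (4 ↑ʳ_) params holds))

  -- None of these numbers depends on the values given to the parameters, which is what permits
  -- giving them exactly these values.
  parameters : Fin 4 → ℕ
  parameters 0F = 7 + N
  parameters 1F = 3 + List.length guards
  parameters 2F = matrixCode (7 + N) (Dynamics.A N)
  parameters 3F = guardsCode Guard.poly guards

  parameterCode-value : ∀ u i {p} → Guard.poly (parameterGuard i (u i)) ≡ p → value u (parameterCode i) ≡ encPoly p
  parameterCode-value u i e = trans (templateCode-value {N} u i (parameterTemplate i)) (cong encPoly (trans poly≡ e))
    where
    poly≡ : fill {N} (u i) (parameterTemplate i) ≡ Guard.poly (parameterGuard i (u i))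
    poly≡ = refl

  loopFor-code : value parameters (instanceCode parameterCode) ≡ encInstance (loopFor parameters)
  loopFor-code = instanceCode-correct (7 + N) (Dynamics.A N) Guard.poly (λ i → parameterGuard i (parameters i)) guards
    {loopFor parameters} parameters parameterCode refl refl refl refl refl (parameterCode-value parameters)

-- No case distinction on termination is made. If `I` terminated, `c` would answer 1 on its code and
-- `I` would not terminate; so `c` answers 0, by determinism it does not answer 1, and `I`
-- terminates after all.
diagonal : ∀ c → Decides c TerminatingOverℤ → (e : Expr) (u : Fin 4 → ℕ) (I : Instance) →
  (Eval (comp c (compile e ∷ [])) (inputs u) 1 → ¬ TerminatingOverℤ I) →
  (¬ Eval (comp c (compile e ∷ [])) (inputs u) 1 → TerminatingOverℤ I) →
  ¬ (value u e ≡ encInstance I)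
diagonal c decides e u I accepted rejected code = ¬terminating (rejected ¬accepted)
  where
  ¬terminating : ¬ TerminatingOverℤ I
  ¬terminating t = accepted (ecomp (subst (λ z → EvalV (compile e ∷ []) (inputs u) (z ∷ [])) code (compile-eval u e ∷ []))
    (proj₁ (decides I) t)) t

  ¬accepted : ¬ Eval (comp c (compile e ∷ [])) (inputs u) 1
  ¬accepted (ecomp (p ∷ []) q) with Eval-deterministic q
    (subst (λ z → Eval c (z ∷ []) 0) (trans (sym code) (Eval-deterministic (compile-eval u e) p))
      (proj₂ (decides I) ¬terminating))
  ... | ()

diagonalForm : ∀ c → Decides c TerminatingOverℤ → (e : Expr) (φ : Form (Fin 4)) →
  (∀ u → Sat u φ → Eval (comp c (compile e ∷ [])) (inputs u) 1) →
  (∀ u → Eval (comp c (compile e ∷ [])) (inputs u) 1 → Sat u φ) →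
  ¬ (value (FormLoop.parameters φ) e ≡ encInstance (FormLoop.loopFor φ (FormLoop.parameters φ)))
diagonalForm c decides e φ to from =
  diagonal c decides e (FormLoop.parameters φ) (FormLoop.loopFor φ (FormLoop.parameters φ))
    (λ p → FormLoop.sat⇒nonterminating φ (FormLoop.parameters φ) (from _ p))
    (λ ¬p → FormLoop.unsat⇒terminating φ (FormLoop.parameters φ) (¬p ∘ to _))

-- The expression `e` has to be correct for every formula, because the formula to which it is
-- applied is itself built from `c` and `e`.
undecidable : ∀ c (e : Expr) →
  ((φ : Form (Fin 4)) → value (FormLoop.parameters φ) e ≡ encInstance (FormLoop.loopFor φ (FormLoop.parameters φ))) →
  ¬ Decides c TerminatingOverℤ
undecidable c e code decides = diagonalForm c decides e (outputOneForm F) (outputOne-sound F) (outputOne-complete F)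
  (code (outputOneForm F))
  where
  F : PR 4
  F = comp c (compile e ∷ [])

theorem1 : ¬ (Σ (PR 1) λ c → Decides c TerminatingOverℤ)
theorem1 (c , decides) = undecidable c (instanceCode parameterCode) FormLoop.loopFor-code decides
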